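{- Let $U$ be a model of $\mathrm{ZFU}_{\mathrm R}$ + Collection + $\mathrm{AC}_\omega$, equipped with its definable classes. The following are equivalent. (1) $U \models$ "$\mathscr{A}$ is a set". (2) $U$ has a definable map (from classes to objects) that fulfills Basic Law V. (3) $U$ has a parametrically definable map (from classes to objects) that fulfills Basic Law V.
   Context: The language of urelement set theory has $\in$ and a unary predicate $\mathscr{A}$ for urelements; $\mathscr{A}$ also denotes the class of all urelements, and a set is an object that is not a urelement. $\mathrm{ZFU}_{\mathrm R}$ has the axioms: urelements have no members; Extensionality for sets (sets with the same members are equal); Foundation; Pairing; Union; Powerset; Infinity; the Separation schema; the Replacement schema. The urelements may form a proper class; "$\mathscr{A}$ is a set" means that some set has exactly the urelements as its members. Collection is the schema $\forall w,u\,(\forall x\in w\,\exists y\,\varphi(x,y,u)\to\exists v\,\forall x\in w\,\exists y\in v\,\varphi(x,y,u))$. $\mathrm{AC}_\omega$ states that every countable family of non-empty sets has a choice function. Given a model $U$, its definable classes are the collections $\{x\in U: U\models\psi(x,z)\}$ with $\psi$ a first-order formula and $z\in U$ a parameter. "Equipped with definable classes" means that we consider the two-sorted structure whose objects are the elements of $U$ and whose classes are the definable classes. A map $X\mapsto\epsilon X$ from classes to objects is definable if its graph is defined over this structure by a second-order formula $\varphi(X,y)$ (quantifiers over objects and over definable classes allowed, no parameters), and parametrically definable if it is defined by a second-order formula $\varphi(X,y,P)$ with a definable class $P$ of $U$ as parameter. It fulfills Basic Law V if for all classes $X,Y$: $\epsilon X=\epsilon Y\leftrightarrow\forall x\,(x\in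 X\leftrightarrow x\in Y)$. -}

module Defs where

open import Data.Empty.Polymorphic using (⊥)
open import Data.Fin using (Fin)
open import Data.Nat using (ℕ; suc)
open import Data.Product using (Σ; ∃; ∃-syntax; ∃!; _×_; _,_)
open import Data.Sum using (_⊎_)
open import Data.Vec using (Vec; []; _∷_; lookup)
open import Function.Bundles using (_⇔_)
open import Level using (Level) renaming (suc to lsuc)
open import Relation.Binary.PropositionalEquality using (_≡_)
open import Relation.Nullary using (¬_)

-- First-order formulas with free variables in Fin n (de Bruijn: a quantifier
-- binds index zero). The remaining connectives are the classical
-- abbreviations, e.g. ∃ for ¬ ∀ ¬.

infixr 5 _⇒_
infix  6 _∈′_ _≈′_ _∈ᶜ_

data Formula (n : ℕ) : Set where
  _∈′_ : Fin n → Fin n → Formula n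
  _≈′_ : Fin n → Fin n → Formula n
  𝒜′   : Fin n → Formula n
  ⊥′   : Formula n
  _⇒_  : Formula n → Formula n → Formula n
  ∀′   : Formula (suc n) → Formula n

-- Second-order formulas with free class variables in Fin m and free object
-- variables in Fin n; x ∈ᶜ X says that the object x belongs to the class X.

data Formula₂ (m n : ℕ) : Set where
  _∈′_ : Fin n → Fin n → Formula₂ m n
  _≈′_ : Fin n → Fin n → Formula₂ m n
  _∈ᶜ_ : Fin n → Fin m → Formula₂ m n
  𝒜′   : Fin n → Formula₂ m n
  ⊥′   : Formula₂ m n
  _⇒_  : Formula₂ m n → Formula₂ m n → Formula₂ m n
  ∀′   : Formula₂ m (suc n) → Formula₂ m n
  ∀ᶜ   : Formula₂ (suc m) n → Formula₂ m n

record Structure (ℓ : Level) : Set (lsuc ℓ) where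
  infix 4 _∈_
  field
    Carrier : Set ℓ
    _∈_     : Carrier → Carrier → Set ℓ
    𝒜       : Carrier → Set ℓ

module _ {ℓ : Level} (U : Structure ℓ) where
  open Structure U

  Sat : ∀ {n} → Formula n → Vec Carrier n → Set ℓ
  Sat (i ∈′ j) e = lookup e i ∈ lookup e j
  Sat (i ≈′ j) e = lookup e i ≡ lookup e j
  Sat (𝒜′ i)   e = 𝒜 (lookup e i)
  Sat ⊥′       e = ⊥
  Sat (φ ⇒ ψ)  e = Sat φ e → Sat ψ e
  Sat (∀′ φ)   e = ∀ x → Sat φ (x ∷ e)

  -- The pair (ψ , z) stands for the class { x ∣ U ⊨ ψ(x , z) }. Different
  -- pairs may present the same class, so classes are only ever compared by
  -- their members.

  Class : Set ℓ
  Class = Formula 2 × Carrier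

  infix 4 _∈Class_

  _∈Class_ : Carrier → Class → Set ℓ
  x ∈Class (ψ , z) = Sat ψ (x ∷ z ∷ [])

  Sat₂ : ∀ {m n} → Formula₂ m n → Vec Class m → Vec Carrier n → Set ℓ
  Sat₂ (i ∈′ j) E e = lookup e i ∈ lookup e j
  Sat₂ (i ≈′ j) E e = lookup e i ≡ lookup e j
  Sat₂ (i ∈ᶜ j) E e = lookup e i ∈Class lookup E j
  Sat₂ (𝒜′ i)   E e = 𝒜 (lookup e i)
  Sat₂ ⊥′       E e = ⊥
  Sat₂ (φ ⇒ ψ)  E e = Sat₂ φ E e → Sat₂ ψ E e
  Sat₂ (∀′ φ)   E e = ∀ x → Sat₂ φ E (x ∷ e)
  Sat₂ (∀ᶜ φ)   E e = ∀ X → Sat₂ φ (X ∷ E) e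

  Definable : (Class → Carrier) → Set ℓ
  Definable ε =
    Σ (Formula₂ 1 1) λ φ →
      ∀ X y → Sat₂ φ (X ∷ []) (y ∷ []) ⇔ (ε X ≡ y)

  ParametricallyDefinable : (Class → Carrier) → Set ℓ
  ParametricallyDefinable ε =
    Σ (Formula₂ 2 1) λ φ → Σ Class λ P →
      ∀ X y → Sat₂ φ (X ∷ P ∷ []) (y ∷ []) ⇔ (ε X ≡ y)

  BasicLawV : (Class → Carrier) → Set ℓ
  BasicLawV ε = ∀ X Y → (ε X ≡ ε Y) ⇔ (∀ x → (x ∈Class X) ⇔ (x ∈Class Y))

  IsSet : Carrier → Set ℓ
  IsSet x = ¬ 𝒜 x

  IsEmptySet : Carrier → Set ℓ
  IsEmptySet x = IsSet x × (∀ z → ¬ (z ∈ x))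

  -- s = x ∪ {x}
  IsSuccessor : Carrier → Carrier → Set ℓ
  IsSuccessor s x = ∀ z → (z ∈ s) ⇔ (z ∈ x ⊎ z ≡ x)

  IsInductive : Carrier → Set ℓ
  IsInductive w =
      (∃[ e ] (e ∈ w × IsEmptySet e))
    × (∀ x → x ∈ w → ∃[ s ] (s ∈ w × IsSuccessor s x))

  -- Membership in ω, the least inductive set.
  IsNatural : Carrier → Set ℓ
  IsNatural k = ∀ w → IsInductive w → k ∈ w

  -- p = {x , y}
  IsPair : Carrier → Carrier → Carrier → Set ℓ
  IsPair p x y = ∀ z → (z ∈ p) ⇔ (z ≡ x ⊎ z ≡ y)

  -- p = {{x} , {x , y}}
  IsOrderedPair : Carrier → Carrier → Carrier → Set ℓ
  IsOrderedPair p x y =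
    ∃[ a ] ∃[ b ] (IsPair a x x × IsPair b x y × IsPair p a b)

  -- f(x) = y
  MapsTo : Carrier → Carrier → Carrier → Set ℓ
  MapsTo f x y = ∃[ p ] (p ∈ f × IsOrderedPair p x y)

  IsFunctionOn : Carrier → Carrier → Set ℓ
  IsFunctionOn f d =
      IsSet f
    × (∀ p → p ∈ f → ∃[ x ] ∃[ y ] (x ∈ d × IsOrderedPair p x y))
    × (∀ x → x ∈ d → ∃! _≡_ (MapsTo f x))

  -- There is an injection into ω; finite sets count as countable.
  IsCountable : Carrier → Set ℓ
  IsCountable w =
    ∃[ f ] ( IsFunctionOn f w
           × (∀ x k → MapsTo f x k → IsNatural k)
           × (∀ x y k → MapsTo f x k → MapsTo f y k → x ≡ y))

  IsChoiceFunctionOn : Carrier → Carrier → Set ℓ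
  IsChoiceFunctionOn f w =
    IsFunctionOn f w × (∀ x y → MapsTo f x y → y ∈ x)

  -- The axioms are written directly as their satisfaction conditions in U;
  -- the schemas range over formulas with finitely many parameters us.

  record ZFUR : Set ℓ where
    field
      urelements-memberless :
        ∀ a → 𝒜 a → ∀ x → ¬ (x ∈ a)
      extensionality :
        ∀ x y → IsSet x → IsSet y → (∀ z → (z ∈ x) ⇔ (z ∈ y)) → x ≡ y
      foundation :
        ∀ x → (∃[ y ] y ∈ x) → ∃[ y ] (y ∈ x × ¬ (∃[ z ] (z ∈ x × z ∈ y)))
      pairing :
        ∀ x y → ∃[ p ] (IsSet p × IsPair p x y)
      union :
        ∀ x → ∃[ v ] (IsSet v × (∀ z → (z ∈ v) ⇔ (∃[ y ] (y ∈ x × z ∈ y))))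
      powerset :
        ∀ x → ∃[ v ] (IsSet v ×
          (∀ y → (y ∈ v) ⇔ (IsSet y × (∀ z → z ∈ y → z ∈ x))))
      infinity :
        ∃[ w ] (IsSet w × IsInductive w)
      separation :
        ∀ {n} (φ : Formula (suc n)) (us : Vec Carrier n) w →
        ∃[ v ] (IsSet v × (∀ x → (x ∈ v) ⇔ (x ∈ w × Sat φ (x ∷ us))))
      replacement :
        ∀ {n} (φ : Formula (suc (suc n))) (us : Vec Carrier n) w →
        (∀ x → x ∈ w → ∃! _≡_ (λ y → Sat φ (x ∷ y ∷ us))) →
        ∃[ v ] (IsSet v ×
          (∀ y → (y ∈ v) ⇔ (∃[ x ] (x ∈ w × Sat φ (x ∷ y ∷ us)))))

  Collection : Set ℓ
  Collection =
    ∀ {n} (φ : Formula (suc (suc n))) (us : Vec Carrier n) w →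
    (∀ x → x ∈ w → ∃[ y ] Sat φ (x ∷ y ∷ us)) →
    ∃[ v ] (∀ x → x ∈ w → ∃[ y ] (y ∈ v × Sat φ (x ∷ y ∷ us)))

  ACω : Set ℓ
  ACω =
    ∀ w → IsSet w → IsCountable w → (∀ x → x ∈ w → ∃[ y ] y ∈ x) →
    ∃[ f ] IsChoiceFunctionOn f w

  UrelementsFormSet : Set ℓ
  UrelementsFormSet = ∃[ s ] (IsSet s × (∀ x → (x ∈ s) ⇔ 𝒜 x))

{-# OPTIONS --safe #-}

-- If 𝒜 is a set, every definable class is coded by a level n, a formula and its parameters, read through the
-- n-th partial truth class. These classes satisfy a recursion on n that determines them uniquely, so a
-- second-order formula can single them out; the abstract of a class consists of the least n that works for
-- it together with the set of its codes of minimal rank at that level (Scott's trick).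
--
-- If 𝒜 is a proper class, let p be the parameter of the abstraction map ε and t₀ a transitive set containing p.
-- Collection and ACω give two disjoint injective ω-sequences of urelements outside t₀, the first with range B.
-- The class X of all c for which c ∩ B is infinite is invariant under transpositions of urelements outside t₀,
-- hence so is ε X, whose transitive closure then contains no urelements outside t₀. So ε X is fixed by the
-- automorphism that exchanges the two sequences; but X is not, contradicting Basic Law V.

module Submission where

open import Defs
open import Axiom.ExcludedMiddle using (ExcludedMiddle)
open import Data.Bool using (Bool; true; false)
open import Data.Empty using (⊥-elim) renaming (⊥ to ⊥₀)
open import Data.Empty.Polymorphic using (⊥)
open import Data.Fin using (Fin; zero; suc; _↑ˡ_; _↑ʳ_; lift)
open import Data.Fin.Patterns
open import Data.Nat using (ℕ; zero; suc; _+_; _⊔_; _≤_; _<_; s≤s; _≤′_; ≤′-refl; ≤′-step)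
open import Data.Nat.Properties
  using (≤-refl; m≤n⇒m≤1+n; <⇒≢; <⇒≤; ≤⇒≤′; m⊔n≤o⇒m≤o; m⊔n≤o⇒n≤o; m≤n⇒m<n∨m≡n)
open import Data.Product using (∃-syntax; ∃!; _×_; _,_; proj₁; proj₂)
open import Data.Sum using (_⊎_; inj₁; inj₂)
open import Data.Vec using (Vec; []; _∷_; lookup; _++_; map)
open import Data.Vec.Properties using (lookup-++ˡ; lookup-++ʳ; lookup-map)
open import Function.Base using (id; _∘_)
open import Function.Bundles using (_⇔_; mk⇔; Equivalence)
open import Function.Construct.Composition using (_⇔-∘_)
open import Function.Construct.Symmetry using (⇔-sym)
open import Function.Related.TypeIsomorphisms using (→-cong-⇔)
open import Relation.Binary.PropositionalEquality
  using (_≡_; refl; sym; trans; cong; cong₂; subst)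
open import Relation.Nullary using (¬_; yes; no)

open Equivalence using (to; from)

-- The natural numbers of `U` may be nonstandard, and the schemas speak of formulas only. Hence
-- every induction or recursion inside `U` is about an explicit formula, while arguments about the
-- syntax run on the external `ℕ` and reach `U` through numerals. `ACω` does not let urelements be
-- picked one after another, as dependent choice would. It does let an injective sequence of length
-- k be picked for every k at once; concatenating these and dropping repetitions leaves an infinite
-- sequence, by the pigeonhole principle. Infinity of c ∩ B is a suitable property because a
-- transposition changes c ∩ B in at most two points, whereas the exchange of the two sequences
-- moves B to a set disjoint from B. Truth is not definable by one formula for all levels, so the
-- abstract has to quantify over classes to reach the truth class of a level. Scott's trick depends
-- on 𝒜 being a set since all urelements have least rank.

infix  8 _∊_ _≐_ _∊ᶜ_
infixr 7 _∧_
infixr 6 _∨_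
infixr 5 _⊃_
infix  4 _⊂⊃_

-- The Boolean index says whether classes may be quantified.
data Fm : Bool → ℕ → ℕ → Set where
  _∊_ _≐_ : ∀ {b m n} → Fin n → Fin n → Fm b m n
  _∊ᶜ_    : ∀ {b m n} → Fin n → Fin m → Fm b m n
  ur      : ∀ {b m n} → Fin n → Fm b m n
  not     : ∀ {b m n} → Fm b m n → Fm b m n
  _∧_ _∨_ _⊃_ _⊂⊃_ : ∀ {b m n} → Fm b m n → Fm b m n → Fm b m n
  all ex  : ∀ {b m n} → Fm b m (suc n) → Fm b m n
  exᶜ     : ∀ {m n} → Fm true (suc m) n → Fm true m n

-- Renaming, semantics and translation into the given syntax

ren : ∀ {m n} → (Fin m → Fin n) → Formula m → Formula n
ren ρ (i ∈′ j) = ρ i ∈′ ρ j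
ren ρ (i ≈′ j) = ρ i ≈′ ρ j
ren ρ (𝒜′ i)   = 𝒜′ (ρ i)
ren ρ ⊥′       = ⊥′
ren ρ (φ ⇒ ψ)  = ren ρ φ ⇒ ren ρ ψ
ren ρ (∀′ φ)   = ∀′ (ren (lift 1 ρ) φ)

renᶜ : ∀ {m k n} → (Fin m → Fin k) → Formula₂ m n → Formula₂ k n
renᶜ ρ (i ∈′ j) = i ∈′ j
renᶜ ρ (i ≈′ j) = i ≈′ j
renᶜ ρ (i ∈ᶜ j) = i ∈ᶜ ρ j
renᶜ ρ (𝒜′ i)   = 𝒜′ i
renᶜ ρ ⊥′       = ⊥′
renᶜ ρ (φ ⇒ ψ)  = renᶜ ρ φ ⇒ renᶜ ρ ψ
renᶜ ρ (∀′ φ)   = ∀′ (renᶜ ρ φ)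
renᶜ ρ (∀ᶜ φ)   = ∀ᶜ (renᶜ (lift 1 ρ) φ)

⇔-refl : ∀ {a} {A : Set a} → A ⇔ A
⇔-refl = mk⇔ id id

≡⇒⇔ : ∀ {a} {A B : Set a} → A ≡ B → A ⇔ B
≡⇒⇔ refl = ⇔-refl

infixr 5 _⇔∘_
_⇔∘_ : ∀ {a b c} {A : Set a} {B : Set b} {C : Set c} → A ⇔ B → B ⇔ C → A ⇔ C
f ⇔∘ g = g ⇔-∘ f

∀-cong : ∀ {a b} {A : Set a} {B B′ : A → Set b} → (∀ x → B x ⇔ B′ x) → (∀ x → B x) ⇔ (∀ x → B′ x)
∀-cong f = mk⇔ (λ h x → to (f x) (h x)) (λ h x → from (f x) (h x))

-- Each connective is interpreted by its Agda counterpart, not through its classical encoding. So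
-- formulas unfold to predicates such as `IsNatural` or `MapsTo`, and a schema applied to a formula
-- yields a statement about the predicate itself.
⟦_⟧ : ∀ {ℓ} (U : Structure ℓ) {b m n} → Fm b m n → Vec (Class U) m → Vec (Structure.Carrier U) n → Set ℓ
⟦ U ⟧ (i ∊ j)  E e = Structure._∈_ U (lookup e i) (lookup e j)
⟦ U ⟧ (i ≐ j)  E e = lookup e i ≡ lookup e j
⟦ U ⟧ (i ∊ᶜ j) E e = _∈Class_ U (lookup e i) (lookup E j)
⟦ U ⟧ (ur i)   E e = Structure.𝒜 U (lookup e i)
⟦ U ⟧ (not φ)  E e = ¬ ⟦ U ⟧ φ E e
⟦ U ⟧ (φ ∧ ψ)  E e = ⟦ U ⟧ φ E e × ⟦ U ⟧ ψ E e
⟦ U ⟧ (φ ∨ ψ)  E e = ⟦ U ⟧ φ E e ⊎ ⟦ U ⟧ ψ E e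
⟦ U ⟧ (φ ⊃ ψ)  E e = ⟦ U ⟧ φ E e → ⟦ U ⟧ ψ E e
⟦ U ⟧ (φ ⊂⊃ ψ) E e = ⟦ U ⟧ φ E e ⇔ ⟦ U ⟧ ψ E e
⟦ U ⟧ (all φ)  E e = ∀ x → ⟦ U ⟧ φ E (x ∷ e)
⟦ U ⟧ (ex φ)   E e = ∃[ x ] ⟦ U ⟧ φ E (x ∷ e)
⟦ U ⟧ (exᶜ φ)  E e = ∃[ X ] ⟦ U ⟧ φ (X ∷ E) e

module Semantics {ℓ} (U : Structure ℓ) where
  open Structure U renaming (Carrier to C)

  sat-ren : ∀ {m n} (φ : Formula m) {ρ : Fin m → Fin n} {e e′} →
            (∀ i → lookup e′ (ρ i) ≡ lookup e i) → Sat U (ren ρ φ) e′ ⇔ Sat U φ e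
  sat-ren (i ∈′ j) h rewrite h i | h j = ⇔-refl
  sat-ren (i ≈′ j) h rewrite h i | h j = ⇔-refl
  sat-ren (𝒜′ i)   h rewrite h i = ⇔-refl
  sat-ren ⊥′       h = ⇔-refl
  sat-ren (φ ⇒ ψ)  h = →-cong-⇔ (sat-ren φ h) (sat-ren ψ h)
  sat-ren (∀′ φ)   h = ∀-cong λ x → sat-ren φ λ { zero → refl ; (suc i) → h i }

  sat-renᶜ : ∀ {m k n} (φ : Formula₂ m n) {ρ : Fin m → Fin k} {E E′ e} →
             (∀ i → lookup E′ (ρ i) ≡ lookup E i) → Sat₂ U (renᶜ ρ φ) E′ e ⇔ Sat₂ U φ E e
  sat-renᶜ (i ∈′ j) h = ⇔-refl
  sat-renᶜ (i ≈′ j) h = ⇔-refl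
  sat-renᶜ (i ∈ᶜ j) h rewrite h j = ⇔-refl
  sat-renᶜ (𝒜′ i)   h = ⇔-refl
  sat-renᶜ ⊥′       h = ⇔-refl
  sat-renᶜ (φ ⇒ ψ)  h = →-cong-⇔ (sat-renᶜ φ h) (sat-renᶜ ψ h)
  sat-renᶜ (∀′ φ)   h = ∀-cong λ x → sat-renᶜ φ h
  sat-renᶜ (∀ᶜ φ)   h = ∀-cong λ X → sat-renᶜ φ λ { zero → refl ; (suc i) → h i }

  -- A first-order formula refers to a class (ψ , z) through ψ and through its parameter z, appended to the assignment.
  record FirstOrder {m n} (P : Vec (Class U) m → Vec C n → Set ℓ) : Set ℓ where
    constructor fo
    field
      formula : Vec (Class U) m → Formula (n + m)
      correct : ∀ E e → Sat U (formula E) (e ++ map proj₂ E) ⇔ P E e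

  record SecondOrder {m n} (P : Vec (Class U) m → Vec C n → Set ℓ) : Set ℓ where
    constructor so
    field
      formula : Formula₂ m n
      correct : ∀ E e → Sat₂ U formula E e ⇔ P E e

  -- The classical encodings rest on falsum, implication and universal quantification alone. They
  -- are justified once, for an arbitrary notion `D`, and then serve `FirstOrder` and `SecondOrder`
  -- alike.
  module Connectives
    (em : ExcludedMiddle ℓ)
    (D : ∀ {m n} → (Vec (Class U) m → Vec C n → Set ℓ) → Set ℓ)
    (respects : ∀ {m n} {P Q : Vec (Class U) m → Vec C n → Set ℓ} → (∀ E e → P E e ⇔ Q E e) → D P → D Q)
    (falsum : ∀ {m n} → D {m} {n} (λ _ _ → ⊥))
    (implies : ∀ {m n} {P Q : Vec (Class U) m → Vec C n → Set ℓ} → D P → D Q → D (λ E e → P E e → Q E e))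
    (forAll : ∀ {m n} {P : Vec (Class U) m → Vec C (suc n) → Set ℓ} → D P → D (λ E e → ∀ x → P E (x ∷ e)))
    where

    byContradiction : {A : Set ℓ} → ¬ ¬ A → A
    byContradiction {A} h with em {A}
    ... | yes a = a
    ... | no ¬a = ⊥-elim (h ¬a)

    ∼_ : ∀ {m n} {P : Vec (Class U) m → Vec C n → Set ℓ} → D P → D (λ E e → ¬ P E e)
    ∼ d = respects (λ E e → mk⇔ (λ h p → absurd (h p)) (λ h p → ⊥-elim (h p))) (implies d falsum)
      where absurd : ⊥ {ℓ} → ⊥₀
            absurd ()

    both : ∀ {m n} {P Q : Vec (Class U) m → Vec C n → Set ℓ} → D P → D Q → D (λ E e → P E e × Q E e)
    both d d′ = respects
      (λ E e → mk⇔ (λ h → byContradiction λ k → h λ p q → k (p , q)) λ { (p , q) h → h p q })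
      (∼ implies d (∼ d′))

    either : ∀ {m n} {P Q : Vec (Class U) m → Vec C n → Set ℓ} → D P → D Q → D (λ E e → P E e ⊎ Q E e)
    either d d′ = respects
      (λ E e → mk⇔ (λ h → byContradiction λ k → k (inj₂ (h (k ∘ inj₁))))
                   λ { (inj₁ p) k → ⊥-elim (k p) ; (inj₂ q) k → q })
      (implies (∼ d) d′)

    iff : ∀ {m n} {P Q : Vec (Class U) m → Vec C n → Set ℓ} → D P → D Q → D (λ E e → P E e ⇔ Q E e)
    iff d d′ = respects (λ E e → mk⇔ (λ { (f , g) → mk⇔ f g }) λ f → to f , from f)
                 (both (implies d d′) (implies d′ d))

    exists : ∀ {m n} {P : Vec (Class U) m → Vec C (suc n) → Set ℓ} → D P → D (λ E e → ∃[ x ] P E (x ∷ e))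
    exists d = respects
      (λ E e → mk⇔ (λ h → byContradiction λ k → h λ x p → k (x , p)) λ { (x , p) h → h x p })
      (∼ forAll (∼ d))

  module Translation (em : ExcludedMiddle ℓ) where

    private
      module F = Connectives em FirstOrder
        (λ h (fo φ c) → fo φ λ E e → c E e ⇔∘ h E e)
        (fo (λ _ → ⊥′) λ _ _ → ⇔-refl)
        (λ (fo φ c) (fo ψ d) → fo (λ E → φ E ⇒ ψ E) λ E e → →-cong-⇔ (c E e) (d E e))
        (λ (fo φ c) → fo (λ E → ∀′ (φ E)) λ E e → ∀-cong λ x → c E (x ∷ e))
      module S = Connectives em SecondOrder
        (λ h (so φ c) → so φ λ E e → c E e ⇔∘ h E e)
        (so ⊥′ λ _ _ → ⇔-refl)
        (λ (so φ c) (so ψ d) → so (φ ⇒ ψ) λ E e → →-cong-⇔ (c E e) (d E e))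
        (λ (so φ c) → so (∀′ φ) λ E e → ∀-cong λ x → c E (x ∷ e))

    open F public using (byContradiction)

    firstOrder : ∀ {m n} (φ : Fm false m n) → FirstOrder (⟦ U ⟧ φ)
    firstOrder {m} (i ∊ j) = fo (λ _ → (i ↑ˡ m) ∈′ (j ↑ˡ m)) λ E e →
      ≡⇒⇔ (cong₂ _∈_ (lookup-++ˡ e (map proj₂ E) i) (lookup-++ˡ e (map proj₂ E) j))
    firstOrder {m} (i ≐ j) = fo (λ _ → (i ↑ˡ m) ≈′ (j ↑ˡ m)) λ E e →
      ≡⇒⇔ (cong₂ _≡_ (lookup-++ˡ e (map proj₂ E) i) (lookup-++ˡ e (map proj₂ E) j))
    -- The formula of the class is spliced in: its member variable becomes `i`, its parameter
    -- variable the slot of the `j`-th class parameter at the end of the assignment.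
    firstOrder {m} {n} (i ∊ᶜ j) =
      fo (λ E → ren position (proj₁ (lookup E j))) λ E e → sat-ren (proj₁ (lookup E j)) λ
        { zero       → lookup-++ˡ e (map proj₂ E) i
        ; (suc zero) → trans (lookup-++ʳ e (map proj₂ E) j) (lookup-map j proj₂ E) }
      where position : Fin 2 → Fin (n + m)
            position zero       = i ↑ˡ m
            position (suc zero) = n ↑ʳ j
    firstOrder {m} (ur i) = fo (λ _ → 𝒜′ (i ↑ˡ m)) λ E e →
      ≡⇒⇔ (cong 𝒜 (lookup-++ˡ e (map proj₂ E) i))
    firstOrder (not φ)  = F.∼ firstOrder φ
    firstOrder (φ ∧ ψ)  = F.both (firstOrder φ) (firstOrder ψ)
    firstOrder (φ ∨ ψ)  = F.either (firstOrder φ) (firstOrder ψ)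
    firstOrder (φ ⊃ ψ)  = fo (λ E → f E ⇒ g E) λ E e → →-cong-⇔ (c E e) (d E e)
      where open FirstOrder (firstOrder φ) renaming (formula to f; correct to c)
            open FirstOrder (firstOrder ψ) renaming (formula to g; correct to d)
    firstOrder (φ ⊂⊃ ψ) = F.iff (firstOrder φ) (firstOrder ψ)
    firstOrder (all φ)  = fo (λ E → ∀′ (f E)) λ E e → ∀-cong λ x → c E (x ∷ e)
      where open FirstOrder (firstOrder φ) renaming (formula to f; correct to c)
    firstOrder (ex φ)   = F.exists (firstOrder φ)

    secondOrder : ∀ {m n} (φ : Fm true m n) → SecondOrder (⟦ U ⟧ φ)
    secondOrder (i ∊ j)  = so (i ∈′ j) λ _ _ → ⇔-refl
    secondOrder (i ≐ j)  = so (i ≈′ j) λ _ _ → ⇔-refl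
    secondOrder (i ∊ᶜ j) = so (i ∈ᶜ j) λ _ _ → ⇔-refl
    secondOrder (ur i)   = so (𝒜′ i) λ _ _ → ⇔-refl
    secondOrder (not φ)  = S.∼ secondOrder φ
    secondOrder (φ ∧ ψ)  = S.both (secondOrder φ) (secondOrder ψ)
    secondOrder (φ ∨ ψ)  = S.either (secondOrder φ) (secondOrder ψ)
    secondOrder (φ ⊃ ψ)  = so (f ⇒ g) λ E e → →-cong-⇔ (c E e) (d E e)
      where open SecondOrder (secondOrder φ) renaming (formula to f; correct to c)
            open SecondOrder (secondOrder ψ) renaming (formula to g; correct to d)
    secondOrder (φ ⊂⊃ ψ) = S.iff (secondOrder φ) (secondOrder ψ)
    secondOrder (all φ)  = so (∀′ f) λ E e → ∀-cong λ x → c E (x ∷ e)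
      where open SecondOrder (secondOrder φ) renaming (formula to f; correct to c)
    secondOrder (ex φ)   = S.exists (secondOrder φ)
    secondOrder (exᶜ φ)  = so (((∀ᶜ (f ⇒ ⊥′)) ⇒ ⊥′)) λ E e →
      mk⇔ (λ h → byContradiction λ k → absurd (h λ X p → ⊥-elim (k (X , to (c (X ∷ E) e) p))))
          λ { (X , p) h → h X (from (c (X ∷ E) e) p) }
      where open SecondOrder (secondOrder φ) renaming (formula to f; correct to c)
            absurd : ⊥ {ℓ} → ⊥₀
            absurd ()

-- Basic set theory and the natural numbers of `U`

setF emptyF naturalF inductiveF : ∀ {b m n} → Fin n → Fm b m n
successorF : ∀ {b m n} → Fin n → Fin n → Fm b m n
pairF orderedPairF mapsToF : ∀ {b m n} → Fin n → Fin n → Fin n → Fm b m n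
relatedF : ∀ {b m n} → Fin m → Fin n → Fin n → Fm b m n
setF x = not (ur x)
emptyF x = setF x ∧ all (not (0F ∊ suc x))
successorF s x = all (0F ∊ suc s ⊂⊃ (0F ∊ suc x ∨ 0F ≐ suc x))
inductiveF w = ex (0F ∊ suc w ∧ emptyF 0F)
             ∧ all (0F ∊ suc w ⊃ ex (0F ∊ suc (suc w) ∧ successorF 0F 1F))
naturalF k = all (inductiveF 0F ⊃ suc k ∊ 0F)
pairF p x y = all (0F ∊ suc p ⊂⊃ (0F ≐ suc x ∨ 0F ≐ suc y))
orderedPairF p x y = ex (ex (pairF 1F (suc (suc x)) (suc (suc x))
                           ∧ pairF 0F (suc (suc x)) (suc (suc y))
                           ∧ pairF (suc (suc p)) 1F 0F))
mapsToF f x y = ex (0F ∊ suc f ∧ orderedPairF 0F (suc x) (suc y))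
relatedF X x y = ex (0F ∊ᶜ X ∧ orderedPairF 0F (suc x) (suc y))

module SetTheory {ℓ} (em : ExcludedMiddle ℓ) (U : Structure ℓ) (Z : ZFUR U) where
  open Structure U renaming (Carrier to C) public
  open Semantics U public
  open Translation em public
  open ZFUR Z

  opaque
    separate : ∀ {m n} (φ : Fm false m (suc n)) E us w →
               ∃[ v ] (IsSet U v × (∀ x → (x ∈ v) ⇔ (x ∈ w × ⟦ U ⟧ φ E (x ∷ us))))
    separate φ E us w with separation (FirstOrder.formula (firstOrder φ) E) (us ++ map proj₂ E) w
    ... | v , set , h = v , set , λ x → h x ⇔∘
          mk⇔ (λ (a , b) → a , to (FirstOrder.correct (firstOrder φ) E (x ∷ us)) b)
              (λ (a , b) → a , from (FirstOrder.correct (firstOrder φ) E (x ∷ us)) b)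

  opaque
    replace : ∀ {m n} (φ : Fm false m (suc (suc n))) E us w →
              (∀ x → x ∈ w → ∃[ y ] ⟦ U ⟧ φ E (x ∷ y ∷ us)) →
              (∀ x y y′ → x ∈ w → ⟦ U ⟧ φ E (x ∷ y ∷ us) → ⟦ U ⟧ φ E (x ∷ y′ ∷ us) → y ≡ y′) →
              ∃[ v ] (IsSet U v × (∀ y → (y ∈ v) ⇔ (∃[ x ] (x ∈ w × ⟦ U ⟧ φ E (x ∷ y ∷ us)))))
    replace {n = n} φ E us w total unique
      with replacement (formula E) (us ++ map proj₂ E) w unique-image
      where
      open FirstOrder (firstOrder φ)
      unique-image : ∀ x → x ∈ w → ∃! _≡_ (λ y → Sat U (formula E) (x ∷ y ∷ us ++ map proj₂ E))
      unique-image x x∈w with total x x∈w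
      ... | y , p = y , from (correct E (x ∷ y ∷ us)) p ,
                    λ {y′} q → unique x y y′ x∈w p (to (correct E (x ∷ y′ ∷ us)) q)
    ... | v , set , h = v , set , λ y → h y ⇔∘
          mk⇔ (λ (x , a , b) → x , a , to (FirstOrder.correct (firstOrder φ) E (x ∷ y ∷ us)) b)
              (λ (x , a , b) → x , a , from (FirstOrder.correct (firstOrder φ) E (x ∷ y ∷ us)) b)

  opaque
    member⇒set : ∀ {z x} → z ∈ x → IsSet U x
    member⇒set z∈x x∈𝒜 = urelements-memberless _ x∈𝒜 _ z∈x

  opaque
    pair : C → C → C
    pair x y = proj₁ (pairing x y)
    pair-set : ∀ x y → IsSet U (pair x y)
    pair-set x y = proj₁ (proj₂ (pairing x y))
    pair-spec : ∀ x y → IsPair U (pair x y) x y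
    pair-spec x y = proj₂ (proj₂ (pairing x y))

  opaque
    pair-unique : ∀ {p x y} → IsPair U p x y → p ≡ pair x y
    pair-unique {p} {x} {y} h =
      extensionality p (pair x y) (member⇒set (from (h x) (inj₁ refl))) (pair-set x y)
        λ z → h z ⇔∘ ⇔-sym (pair-spec x y z)

  ∈-pairˡ : ∀ {x y} → x ∈ pair x y
  ∈-pairˡ {x} {y} = from (pair-spec x y x) (inj₁ refl)

  ∈-pairʳ : ∀ {x y} → y ∈ pair x y
  ∈-pairʳ {x} {y} = from (pair-spec x y y) (inj₂ refl)

  opaque
    ∈-pair⁻ : ∀ {x y z} → z ∈ pair x y → z ≡ x ⊎ z ≡ y
    ∈-pair⁻ {x} {y} {z} = to (pair-spec x y z)

  opaque
    ∈-singleton⁻ : ∀ {x z} → z ∈ pair x x → z ≡ x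
    ∈-singleton⁻ h with ∈-pair⁻ h
    ... | inj₁ e = e
    ... | inj₂ e = e

  ⟪_,_⟫ : C → C → C
  ⟪ x , y ⟫ = pair (pair x x) (pair x y)

  opaque
    ordered-pair : ∀ x y → IsOrderedPair U ⟪ x , y ⟫ x y
    ordered-pair x y = _ , _ , pair-spec x x , pair-spec x y , pair-spec _ _

  opaque
    ordered-pair-unique : ∀ {p x y} → IsOrderedPair U p x y → p ≡ ⟪ x , y ⟫
    ordered-pair-unique (a , b , ha , hb , hp) with pair-unique ha | pair-unique hb
    ... | refl | refl = pair-unique hp

  private
    ∈-⟪⟫⁻ : ∀ {a x y u} → a ∈ ⟪ x , y ⟫ → u ∈ a → u ≡ x ⊎ u ≡ y
    ∈-⟪⟫⁻ a∈ u∈a with ∈-pair⁻ a∈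
    ... | inj₁ refl = inj₁ (∈-singleton⁻ u∈a)
    ... | inj₂ refl = ∈-pair⁻ u∈a

  opaque
    ⟪⟫-injective : ∀ {x y x′ y′} → ⟪ x , y ⟫ ≡ ⟪ x′ , y′ ⟫ → x ≡ x′ × y ≡ y′
    ⟪⟫-injective {x} {y} {x′} {y′} eq = first , second first
      where
      first : x ≡ x′
      first with ∈-pair⁻ (subst (pair x x ∈_) eq ∈-pairˡ)
      ... | inj₁ e = ∈-singleton⁻ (subst (x ∈_) e ∈-pairˡ)
      ... | inj₂ e = sym (∈-singleton⁻ (subst (x′ ∈_) (sym e) ∈-pairˡ))
      second : x ≡ x′ → y ≡ y′
      second refl with ∈-⟪⟫⁻ (subst (pair x y ∈_) eq ∈-pairʳ) ∈-pairʳ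
                     | ∈-⟪⟫⁻ (subst (pair x y′ ∈_) (sym eq) ∈-pairʳ) ∈-pairʳ
      ... | inj₂ e | _       = e
      ... | _      | inj₂ e  = sym e
      ... | inj₁ e | inj₁ e′ = trans e (sym e′)

  opaque
    mapsTo⇒∈ : ∀ {f x y} → MapsTo U f x y → ⟪ x , y ⟫ ∈ f
    mapsTo⇒∈ {f} (p , p∈f , op) = subst (_∈ f) (ordered-pair-unique op) p∈f

  opaque
    ∈⇒mapsTo : ∀ {f x y} → ⟪ x , y ⟫ ∈ f → MapsTo U f x y
    ∈⇒mapsTo p∈f = _ , p∈f , ordered-pair _ _

  opaque
    ⋃ : C → C
    ⋃ x = proj₁ (union x)
    ⋃-set : ∀ x → IsSet U (⋃ x)
    ⋃-set x = proj₁ (proj₂ (union x))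
    ⋃-spec : ∀ {x} z → (z ∈ ⋃ x) ⇔ (∃[ y ] (y ∈ x × z ∈ y))
    ⋃-spec {x} = proj₂ (proj₂ (union x))

  infixl 6 _∪_
  _∪_ : C → C → C
  x ∪ y = ⋃ (pair x y)

  opaque
    ∈-∪ˡ : ∀ {x y z} → z ∈ x → z ∈ x ∪ y
    ∈-∪ˡ h = from (⋃-spec _) (_ , ∈-pairˡ , h)

  opaque
    ∈-∪ʳ : ∀ {x y z} → z ∈ y → z ∈ x ∪ y
    ∈-∪ʳ h = from (⋃-spec _) (_ , ∈-pairʳ , h)

  opaque
    ∈-∪⁻ : ∀ {x y z} → z ∈ x ∪ y → z ∈ x ⊎ z ∈ y
    ∈-∪⁻ h with to (⋃-spec _) h
    ... | a , a∈ , z∈a with ∈-pair⁻ a∈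
    ... | inj₁ refl = inj₁ z∈a
    ... | inj₂ refl = inj₂ z∈a

  adjoin : C → C → C
  adjoin x y = x ∪ pair y y

  opaque
    adjoin-spec : ∀ {x y} z → (z ∈ adjoin x y) ⇔ (z ∈ x ⊎ z ≡ y)
    adjoin-spec {x} {y} z = mk⇔ forth λ { (inj₁ h) → ∈-∪ˡ h ; (inj₂ refl) → ∈-∪ʳ ∈-pairˡ }
      where
      forth : z ∈ adjoin x y → z ∈ x ⊎ z ≡ y
      forth h with ∈-∪⁻ h
      ... | inj₁ h′ = inj₁ h′
      ... | inj₂ h′ = inj₂ (∈-singleton⁻ h′)

  opaque
    mapsTo-⋃⋃ : ∀ {f x y} → MapsTo U f x y → y ∈ ⋃ (⋃ f)
    mapsTo-⋃⋃ h = from (⋃-spec _) (_ , from (⋃-spec _) (_ , mapsTo⇒∈ h , ∈-pairʳ) , ∈-pairʳ)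

  opaque
    mapsTo-adjoin : ∀ {f x y u v} → MapsTo U (adjoin f ⟪ x , y ⟫) u v → MapsTo U f u v ⊎ (u ≡ x × v ≡ y)
    mapsTo-adjoin h with to (adjoin-spec _) (mapsTo⇒∈ h)
    ... | inj₁ p = inj₁ (∈⇒mapsTo p)
    ... | inj₂ e = inj₂ (⟪⟫-injective e)

  opaque
    ∉-refl : ∀ {x} → ¬ x ∈ x
    ∉-refl {x} x∈x with foundation (pair x x) (x , ∈-pairˡ)
    ... | y , y∈ , h with ∈-singleton⁻ y∈
    ... | refl = h (x , ∈-pairˡ , x∈x)

  opaque
    ∉-asym : ∀ {x y} → x ∈ y → ¬ y ∈ x
    ∉-asym {x} {y} x∈y y∈x with foundation (pair x y) (x , ∈-pairˡ)
    ... | z , z∈ , h with ∈-pair⁻ z∈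
    ... | inj₁ refl = h (y , ∈-pairʳ , y∈x)
    ... | inj₂ refl = h (x , ∈-pairˡ , x∈y)

  opaque
    ∅ : C
    ∅ = proj₁ (proj₁ (proj₂ (proj₂ infinity)))
    ∅-empty : IsEmptySet U ∅
    ∅-empty = proj₂ (proj₂ (proj₁ (proj₂ (proj₂ infinity))))

  opaque
    ∉-∅ : ∀ {z} → ¬ z ∈ ∅
    ∉-∅ = proj₂ ∅-empty _

  opaque
    ∅-unique : ∀ {x} → IsEmptySet U x → x ≡ ∅
    ∅-unique {x} (set , none) = extensionality x ∅ set (proj₁ ∅-empty)
      λ z → mk⇔ (⊥-elim ∘ none z) (⊥-elim ∘ ∉-∅)

  succ : C → C
  succ x = adjoin x x

  opaque
    succ-unique : ∀ {s x} → IsSuccessor U s x → s ≡ succ x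
    succ-unique {s} {x} h = extensionality s (succ x) (member⇒set (from (h x) (inj₂ refl))) (⋃-set _)
      λ z → h z ⇔∘ ⇔-sym (adjoin-spec z)

  succ-spec : ∀ x → IsSuccessor U (succ x) x
  succ-spec x = adjoin-spec

  opaque
    ∈-succ : ∀ {x} → x ∈ succ x
    ∈-succ = from (adjoin-spec _) (inj₂ refl)

  succ≢∅ : ∀ {x} → ¬ succ x ≡ ∅
  succ≢∅ eq = ∉-∅ (subst (_ ∈_) eq ∈-succ)

  opaque
    succ-injective : ∀ {x y} → succ x ≡ succ y → x ≡ y
    succ-injective {x} {y} eq with to (adjoin-spec x) (subst (x ∈_) eq ∈-succ)
                                 | to (adjoin-spec y) (subst (y ∈_) (sym eq) ∈-succ)
    ... | inj₂ e   | _        = e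
    ... | inj₁ _   | inj₂ e   = sym e
    ... | inj₁ x∈y | inj₁ y∈x = ⊥-elim (∉-asym x∈y y∈x)

  Natural : C → Set ℓ
  Natural = IsNatural U

  opaque
    natural-∅ : Natural ∅
    natural-∅ w ((e , e∈w , h) , _) = subst (_∈ w) (∅-unique h) e∈w

  opaque
    natural-succ : ∀ {k} → Natural k → Natural (succ k)
    natural-succ h w ind with proj₂ ind _ (h w ind)
    ... | s , s∈w , hs = subst (_∈ w) (succ-unique hs) s∈w

  opaque
    ω : C
    ω = proj₁ (separate {m = 0} (naturalF 0F) [] [] (proj₁ infinity))
    ω-spec : ∀ {k} → (k ∈ ω) ⇔ Natural k
    ω-spec {k} = mk⇔ (λ p → proj₂ (to h p)) λ p → from h (p _ (proj₂ (proj₂ infinity)) , p)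
      where h : (k ∈ ω) ⇔ (k ∈ proj₁ infinity × Natural k)
            h = proj₂ (proj₂ (separate {m = 0} (naturalF 0F) [] [] (proj₁ infinity))) k

  opaque
    -- Separation cuts the good numbers out of `ω`, and they form an inductive set. An explicit
    -- formula is required because `ω` may contain nonstandard numbers, which no recursion on `ℕ`
    -- reaches.
    induction : ∀ {m n} (φ : Fm false m (suc n)) E us → ⟦ U ⟧ φ E (∅ ∷ us) →
                (∀ k → Natural k → ⟦ U ⟧ φ E (k ∷ us) → ⟦ U ⟧ φ E (succ k ∷ us)) →
                ∀ k → Natural k → ⟦ U ⟧ φ E (k ∷ us)
    induction φ E us base step k nat with separate φ E us ω
    ... | v , _ , h = proj₂ (to (h k) (nat v (zero-in , succ-in)))
      where
      zero-in : ∃[ e ] (e ∈ v × IsEmptySet U e)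
      zero-in = ∅ , from (h ∅) (from ω-spec natural-∅ , base) , ∅-empty
      succ-in : ∀ x → x ∈ v → ∃[ s ] (s ∈ v × IsSuccessor U s x)
      succ-in x x∈v with to (h x) x∈v
      ... | x∈ω , p = succ x ,
            from (h _) (from ω-spec (natural-succ (to ω-spec x∈ω)) , step x (to ω-spec x∈ω) p) , succ-spec x

  opaque
    natural-∈ : ∀ k → Natural k → ∀ j → j ∈ k → Natural j
    natural-∈ = induction {m = 0} (all (0F ∊ 1F ⊃ naturalF 0F)) [] [] (λ j → ⊥-elim ∘ ∉-∅) step
      where
      step : ∀ k → Natural k → (∀ j → j ∈ k → Natural j) → ∀ j → j ∈ succ k → Natural j
      step k nat ih j j∈ with to (adjoin-spec j) j∈
      ... | inj₁ j∈k  = ih j j∈k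
      ... | inj₂ refl = nat

  opaque
    natural-transitive : ∀ k → Natural k → ∀ j → j ∈ k → ∀ i → i ∈ j → i ∈ k
    natural-transitive = induction {m = 0} (all (0F ∊ 1F ⊃ all (0F ∊ 1F ⊃ 0F ∊ 2F))) [] []
      (λ j → ⊥-elim ∘ ∉-∅) step
      where
      step : ∀ k → Natural k → (∀ j → j ∈ k → ∀ i → i ∈ j → i ∈ k) →
             ∀ j → j ∈ succ k → ∀ i → i ∈ j → i ∈ succ k
      step k nat ih j j∈ i i∈j with to (adjoin-spec j) j∈
      ... | inj₁ j∈k  = ∈-∪ˡ (ih j j∈k i i∈j)
      ... | inj₂ refl = ∈-∪ˡ i∈j

  private
    opaque
      ∅-least : ∀ k → Natural k → (∃[ e ] (IsEmptySet U e × (e ≡ k ⊎ e ∈ k)))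
      ∅-least = induction {m = 0} (ex (emptyF 0F ∧ (0F ≐ 1F ∨ 0F ∊ 1F))) [] []
        (∅ , ∅-empty , inj₁ refl)
        λ { k _ (e , h , inj₁ refl) → e , h , inj₂ ∈-succ
          ; k _ (e , h , inj₂ e∈k) → e , h , inj₂ (∈-∪ˡ e∈k) }

    opaque
      succ-least : ∀ {i} k → Natural k → i ∈ k → (∃[ s ] (IsSuccessor U s i × (s ≡ k ⊎ s ∈ k)))
      succ-least {i} = induction {m = 0} (1F ∊ 0F ⊃ ex (successorF 0F 2F ∧ (0F ≐ 1F ∨ 0F ∊ 1F))) [] (i ∷ [])
        (⊥-elim ∘ ∉-∅) step
        where
        step : ∀ k → Natural k → (i ∈ k → ∃[ s ] (IsSuccessor U s i × (s ≡ k ⊎ s ∈ k))) →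
               i ∈ succ k → ∃[ s ] (IsSuccessor U s i × (s ≡ succ k ⊎ s ∈ succ k))
        step k _ ih i∈ with to (adjoin-spec i) i∈
        ... | inj₂ refl = succ k , succ-spec k , inj₁ refl
        ... | inj₁ i∈k with ih i∈k
        ... | s , h , inj₁ refl = s , h , inj₂ ∈-succ
        ... | s , h , inj₂ s∈k  = s , h , inj₂ (∈-∪ˡ s∈k)

  opaque
    trichotomy : ∀ k → Natural k → ∀ j → Natural j → k ∈ j ⊎ k ≡ j ⊎ j ∈ k
    trichotomy k nat j = induction {m = 0} (naturalF 1F ⊃ (0F ∊ 1F ∨ 0F ≐ 1F ∨ 1F ∊ 0F)) [] (j ∷ []) base step k nat
      where
      base : Natural j → ∅ ∈ j ⊎ ∅ ≡ j ⊎ j ∈ ∅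
      base h with ∅-least j h
      ... | e , empty , d with ∅-unique empty
      ... | refl with d
      ... | inj₁ p = inj₂ (inj₁ p)
      ... | inj₂ p = inj₁ p
      step : ∀ i → Natural i → (Natural j → i ∈ j ⊎ i ≡ j ⊎ j ∈ i) →
             Natural j → succ i ∈ j ⊎ succ i ≡ j ⊎ j ∈ succ i
      step i _ ih h with ih h
      ... | inj₂ (inj₁ refl) = inj₂ (inj₂ ∈-succ)
      ... | inj₂ (inj₂ j∈i)  = inj₂ (inj₂ (∈-∪ˡ j∈i))
      ... | inj₁ i∈j with succ-least j h i∈j
      ... | s , hs , d with succ-unique hs
      ... | refl with d
      ... | inj₁ p = inj₂ (inj₁ p)
      ... | inj₂ p = inj₁ p

  opaque
    least-natural : ∀ {m n} (φ : Fm false m (suc n)) E us k → Natural k → ⟦ U ⟧ φ E (k ∷ us) →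
                    ∃[ j ] (Natural j × ⟦ U ⟧ φ E (j ∷ us) × (∀ i → i ∈ j → ¬ ⟦ U ⟧ φ E (i ∷ us)))
    least-natural φ E us k nat p with separate φ E us ω
    ... | v , _ , h with foundation v (k , from (h k) (from ω-spec nat , p))
    ... | j , j∈v , none with to (h j) j∈v
    ... | j∈ω , q = j , to ω-spec j∈ω , q ,
          λ i i∈j r → none (i , from (h i) (from ω-spec (natural-∈ j (to ω-spec j∈ω) i i∈j) , r) , i∈j)

-- Classes with several parameters, recursion and ∈-induction

related₃F : ∀ {b m n} → Fin m → Fin n → Fin n → Fin n → Fm b m n
related₃F X x y z = ex (orderedPairF 0F (suc y) (suc z) ∧ relatedF X (suc x) 0F)

-- Unfolds to `Iterate` of the module `Iteration` when `B` and `G` are its classes `Start` and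
-- `Next`, so that `induction` can speak of iterates.
iterateF : ∀ {b m n} → Fin m → Fin m → Fin n → Fin n → Fm b m n
iterateF B G k y = ex (mapsToF 0F (suc k) (suc y) ∧ all (all (mapsToF 2F 1F 0F ⊃
  (emptyF 1F ∧ 0F ∊ᶜ B) ∨
  ex (successorF 2F 0F ∧ ex (mapsToF 4F 1F 0F ∧ related₃F G 1F 0F 2F)))))

extendsF : ∀ {b m n} → Fin n → Fin n → Fin n → Fin n → Fm b m n
extendsF z y k a = ex (orderedPairF 0F (suc k) (suc a) ∧
  all (0F ∊ suc (suc z) ⊂⊃ (0F ∊ suc (suc y) ∨ 0F ≐ 1F)))

module Recursion {ℓ} (em : ExcludedMiddle ℓ) (U : Structure ℓ) (Z : ZFUR U) (collection : Collection U) where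
  open SetTheory em U Z public
  open ZFUR Z

  opaque
    collect : ∀ {m n} (φ : Fm false m (suc (suc n))) E us w →
              (∀ x → x ∈ w → ∃[ y ] ⟦ U ⟧ φ E (x ∷ y ∷ us)) →
              ∃[ v ] (∀ x → x ∈ w → ∃[ y ] (y ∈ v × ⟦ U ⟧ φ E (x ∷ y ∷ us)))
    collect φ E us w total
      with collection (formula E) (us ++ map proj₂ E) w
             (λ x x∈w → proj₁ (total x x∈w) , from (correct E (x ∷ _ ∷ us)) (proj₂ (total x x∈w)))
      where open FirstOrder (firstOrder φ)
    ... | v , h = v , λ x x∈w → proj₁ (h x x∈w) , proj₁ (proj₂ (h x x∈w)) ,
          to (FirstOrder.correct (firstOrder φ) E (x ∷ _ ∷ us)) (proj₂ (proj₂ (h x x∈w)))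

  opaque
    orderedPairFormula : Formula 3
    orderedPairFormula = FirstOrder.formula (firstOrder {0} (orderedPairF 0F 1F 2F)) []
    orderedPairFormula-spec : ∀ {p x y} → Sat U orderedPairFormula (p ∷ x ∷ y ∷ []) ⇔ IsOrderedPair U p x y
    orderedPairFormula-spec = FirstOrder.correct (firstOrder {0} (orderedPairF 0F 1F 2F)) [] (_ ∷ _ ∷ _ ∷ [])

  private
    reversed : ∀ {k} → Fin 3 → Fin (suc (suc (suc k)))
    reversed 0F = 2F
    reversed 1F = 1F
    reversed 2F = 0F
    skip : ∀ {k} → Fin (suc (suc k)) → Fin (suc (suc (suc k)))
    skip 0F = 1F
    skip 1F = 0F
    skip (suc (suc i)) = suc (suc (suc i))
    rotate : ∀ {k} → Fin (suc (suc (suc k))) → Fin (suc (suc (suc k)))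
    rotate 0F = 2F
    rotate 1F = 0F
    rotate 2F = 1F
    rotate (suc (suc (suc i))) = suc (suc (suc i))
    swap : ∀ {k} → Fin (suc (suc k)) → Fin (suc (suc k))
    swap 0F = 1F
    swap 1F = 0F
    swap (suc (suc i)) = suc (suc i)

  opaque
    -- The universal form holds of every object that is no pair. This does no harm, since `class₂`
    -- and `class₃` are read through `Related` and `Related₃`, which look at pairs only.
    pack : ∀ {k} → Formula (suc (suc k)) → Formula (suc k)
    pack φ = ∀′ (∀′ (ren reversed orderedPairFormula ⇒ ren skip φ))
    pack-spec : ∀ {k} (φ : Formula (suc (suc k))) x y (us : Vec C k) →
                Sat U (pack φ) (⟪ x , y ⟫ ∷ us) ⇔ Sat U φ (x ∷ y ∷ us)
    pack-spec {k} φ x y us = mk⇔ forth back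
      where
      pair-part : ∀ {p a b} → Sat U (ren reversed orderedPairFormula) (b ∷ a ∷ p ∷ us) ⇔ IsOrderedPair U p a b
      pair-part {p} {a} {b} =
        sat-ren orderedPairFormula {reversed} {p ∷ a ∷ b ∷ []} {b ∷ a ∷ p ∷ us} (λ { 0F → refl ; 1F → refl ; 2F → refl })
        ⇔∘ orderedPairFormula-spec
      body : ∀ {p a b} → Sat U (ren skip φ) (b ∷ a ∷ p ∷ us) ⇔ Sat U φ (a ∷ b ∷ us)
      body {p} {a} {b} = sat-ren φ {skip} {a ∷ b ∷ us} {b ∷ a ∷ p ∷ us} λ { 0F → refl ; 1F → refl ; (suc (suc i)) → refl }
      forth : Sat U (pack φ) (⟪ x , y ⟫ ∷ us) → Sat U φ (x ∷ y ∷ us)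
      forth h = to body (h x y (from pair-part (ordered-pair x y)))
      back : Sat U φ (x ∷ y ∷ us) → Sat U (pack φ) (⟪ x , y ⟫ ∷ us)
      back h a b op with ⟪⟫-injective (ordered-pair-unique (to pair-part op))
      ... | refl , refl = from body h

  opaque
    packʳ : ∀ {k} → Formula (suc (suc (suc k))) → Formula (suc (suc k))
    packʳ φ = ren swap (pack (ren rotate φ))
    packʳ-spec : ∀ {k} (φ : Formula (suc (suc (suc k)))) x y z (us : Vec C k) →
                 Sat U (packʳ φ) (x ∷ ⟪ y , z ⟫ ∷ us) ⇔ Sat U φ (x ∷ y ∷ z ∷ us)
    packʳ-spec φ x y z us =
      sat-ren (pack (ren rotate φ)) {swap} {⟪ y , z ⟫ ∷ x ∷ us} (λ { 0F → refl ; 1F → refl ; (suc (suc i)) → refl })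
      ⇔∘ pack-spec (ren rotate φ) y z (x ∷ us)
      ⇔∘ sat-ren φ {rotate} {x ∷ y ∷ z ∷ us} λ { 0F → refl ; 1F → refl ; 2F → refl ; (suc (suc (suc i))) → refl }

  -- A class carries exactly one parameter. A longer list is folded into nested ordered pairs, an
  -- empty one is replaced by the default `∅`.
  classOf : ∀ {k} → Formula (suc k) → Vec C k → Class U
  classOf φ []            = ren (λ { 0F → 0F }) φ , ∅
  classOf φ (z ∷ [])      = φ , z
  classOf φ (a ∷ b ∷ us)  = classOf (packʳ φ) (⟪ a , b ⟫ ∷ us)

  opaque
    classOf-spec : ∀ {k} (φ : Formula (suc k)) (us : Vec C k) {x} →
                   _∈Class_ U x (classOf φ us) ⇔ Sat U φ (x ∷ us)
    classOf-spec φ []           = sat-ren φ λ { 0F → refl }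
    classOf-spec φ (z ∷ [])     = ⇔-refl
    classOf-spec φ (a ∷ b ∷ us) = classOf-spec (packʳ φ) (⟪ a , b ⟫ ∷ us) ⇔∘ packʳ-spec φ _ a b us

  Related : Class U → C → C → Set ℓ
  Related X x y = ∃[ p ] (_∈Class_ U p X × IsOrderedPair U p x y)

  Related₃ : Class U → C → C → C → Set ℓ
  Related₃ X x y z = ∃[ q ] (IsOrderedPair U q y z × Related X x q)

  opaque
    related⇔∈ : ∀ X {x y} → Related X x y ⇔ _∈Class_ U ⟪ x , y ⟫ X
    related⇔∈ X = mk⇔ (λ (p , h , op) → subst (λ p → _∈Class_ U p X) (ordered-pair-unique op) h)
                        (λ h → _ , h , ordered-pair _ _)

  opaque
    related₃⇔∈ : ∀ X {x y z} → Related₃ X x y z ⇔ _∈Class_ U ⟪ x , ⟪ y , z ⟫ ⟫ X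
    related₃⇔∈ X {x} = mk⇔
      (λ (q , op , h) → to (related⇔∈ X) (subst (Related X x) (ordered-pair-unique op) h))
      (λ h → _ , ordered-pair _ _ , from (related⇔∈ X) h)

  module _ {m n : ℕ} where
    private
      raw : ∀ {k} → Fm false m (k + n) → Vec (Class U) m → Formula (k + n + m)
      raw φ E = FirstOrder.formula (firstOrder φ) E

    opaque
      class₁ : Fm false m (suc n) → Vec (Class U) m → Vec C n → Class U
      class₁ φ E us = classOf (raw {1} φ E) (us ++ map proj₂ E)
      class₁-spec : ∀ φ {E us x} → _∈Class_ U x (class₁ φ E us) ⇔ ⟦ U ⟧ φ E (x ∷ us)
      class₁-spec φ {E} {us} {x} = classOf-spec (raw {1} φ E) (us ++ map proj₂ E)
                                   ⇔∘ FirstOrder.correct (firstOrder φ) E (x ∷ us)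

    opaque
      class₂ : Fm false m (suc (suc n)) → Vec (Class U) m → Vec C n → Class U
      class₂ φ E us = classOf (pack (raw {2} φ E)) (us ++ map proj₂ E)
      class₂-spec : ∀ φ {E us x y} → Related (class₂ φ E us) x y ⇔ ⟦ U ⟧ φ E (x ∷ y ∷ us)
      class₂-spec φ {E} {us} {x} {y} =
        related⇔∈ (class₂ φ E us) ⇔∘ classOf-spec _ (us ++ map proj₂ E)
        ⇔∘ pack-spec (raw {2} φ E) x y _ ⇔∘ FirstOrder.correct (firstOrder φ) E (x ∷ y ∷ us)

    opaque
      class₃ : Fm false m (suc (suc (suc n))) → Vec (Class U) m → Vec C n → Class U
      class₃ φ E us = classOf (pack (packʳ (raw {3} φ E))) (us ++ map proj₂ E)
      class₃-spec : ∀ φ {E us x y z} → Related₃ (class₃ φ E us) x y z ⇔ ⟦ U ⟧ φ E (x ∷ y ∷ z ∷ us)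
      class₃-spec φ {E} {us} {x} {y} {z} =
        related₃⇔∈ (class₃ φ E us) ⇔∘ classOf-spec _ (us ++ map proj₂ E)
        ⇔∘ pack-spec (packʳ (raw {3} φ E)) x ⟪ y , z ⟫ _
        ⇔∘ packʳ-spec (raw {3} φ E) x y z _ ⇔∘ FirstOrder.correct (firstOrder φ) E (x ∷ y ∷ z ∷ us)

  -- The union of all relations f with Φ f ⊇ f, restricted to sets f: a greatest fixed point of Φ, hence
  -- definable by a single quantifier over sets. Well-foundedness makes it the unique fixed point.
  module Corecursion
    (Φ : (C → C → Set ℓ) → C → C → Set ℓ)
    (mono : ∀ {S S′ : C → C → Set ℓ} → (∀ {x y} → S x y → S′ x y) → ∀ {x y} → Φ S x y → Φ S′ x y)
    where

    Closed : C → Set ℓ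
    Closed f = ∀ x y → MapsTo U f x y → Φ (MapsTo U f) x y

    Fix : C → C → Set ℓ
    Fix x y = ∃[ f ] (MapsTo U f x y × Closed f)

    unfold : ∀ {x y} → Fix x y → Φ Fix x y
    unfold {x} {y} (f , h , closed) = mono (λ k → f , k , closed) (closed x y h)

    -- By monotonicity, the union of the witnesses in `F` stays closed when the new pair is added.
    -- The witnesses have to form a set, which is why `Collection` comes in wherever one is needed
    -- for each member of a set.
    fold : ∀ {x y} F → (∀ f → f ∈ F → Closed f) → Φ (λ a b → ∃[ f ] (f ∈ F × MapsTo U f a b)) x y → Fix x y
    fold {x} {y} F closed φ = g , ∈⇒mapsTo (from (adjoin-spec _) (inj₂ refl)) , g-closed
      where
      g : C
      g = adjoin (⋃ F) ⟪ x , y ⟫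
      into-g : ∀ {a b} → ∃[ f ] (f ∈ F × MapsTo U f a b) → MapsTo U g a b
      into-g (f , f∈F , h) = ∈⇒mapsTo (∈-∪ˡ (from (⋃-spec _) (f , f∈F , mapsTo⇒∈ h)))
      g-closed : Closed g
      g-closed u v h with mapsTo-adjoin h
      ... | inj₂ (refl , refl) = mono into-g φ
      ... | inj₁ h′ with to (⋃-spec _) (mapsTo⇒∈ h′)
      ... | f , f∈F , p = mono (λ k → into-g (f , f∈F , k)) (closed f f∈F u v (∈⇒mapsTo p))

  Extends : C → C → C → C → Set ℓ
  Extends z y k a = ∃[ p ] (IsOrderedPair U p k a × (∀ q → (q ∈ z) ⇔ (q ∈ y ⊎ q ≡ p)))

  opaque
    extends-adjoin : ∀ y k a → Extends (adjoin y ⟪ k , a ⟫) y k a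
    extends-adjoin y k a = _ , ordered-pair k a , adjoin-spec

  opaque
    extends-old : ∀ {z y k a} → Extends z y k a → ∀ {u v} → MapsTo U y u v → MapsTo U z u v
    extends-old (p , _ , h) m = ∈⇒mapsTo (from (h _) (inj₁ (mapsTo⇒∈ m)))

  opaque
    extends-new : ∀ {z y k a} → Extends z y k a → MapsTo U z k a
    extends-new (p , o , h) = p , from (h p) (inj₂ refl) , o

  opaque
    extends⁻ : ∀ {z y k a} → Extends z y k a → ∀ {u v} → MapsTo U z u v → MapsTo U y u v ⊎ (u ≡ k × v ≡ a)
    extends⁻ (p , o , h) m with to (h _) (mapsTo⇒∈ m)
    ... | inj₁ q∈ = inj₁ (∈⇒mapsTo q∈)
    ... | inj₂ e  = inj₂ (⟪⟫-injective (trans e (ordered-pair-unique o)))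

  opaque
    extends-unique : ∀ {z z′ y k a} → Extends z y k a → Extends z′ y k a → z ≡ z′
    extends-unique (p , o , h) (p′ , o′ , h′) with trans (ordered-pair-unique o) (sym (ordered-pair-unique o′))
    ... | refl = extensionality _ _ (member⇒set (from (h p) (inj₂ refl))) (member⇒set (from (h′ p) (inj₂ refl)))
                   λ q → h q ⇔∘ ⇔-sym (h′ q)

  -- `next` may relate a value to many others or to none, as in the case of `Sequence` and
  -- `AtLeast`; totality and uniqueness are proved separately where they hold.
  module Iteration {m n : ℕ} (E : Vec (Class U) m) (us : Vec C n)
                   (start : Fm false m (suc n)) (next : Fm false m (suc (suc (suc n)))) where

    Start Next : Class U
    Start = class₁ start E us
    Next  = class₃ next E us

    private
      Φ : (C → C → Set ℓ) → C → C → Set ℓ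
      Φ S k y = (IsEmptySet U k × _∈Class_ U y Start)
              ⊎ (∃[ j ] (IsSuccessor U k j × ∃[ x ] (S j x × Related₃ Next j x y)))

      Φ-mono : ∀ {S S′ : C → C → Set ℓ} → (∀ {x y} → S x y → S′ x y) → ∀ {x y} → Φ S x y → Φ S′ x y
      Φ-mono i (inj₁ h)                   = inj₁ h
      Φ-mono i (inj₂ (j , s , x , h , r)) = inj₂ (j , s , x , i h , r)

    open Corecursion Φ Φ-mono renaming (Fix to Iterate) public

    opaque
      iterate-zero : ∀ {y} → ⟦ U ⟧ start E (y ∷ us) → Iterate ∅ y
      iterate-zero h = fold ∅ (λ f → ⊥-elim ∘ ∉-∅) (inj₁ (∅-empty , from (class₁-spec start) h))

    opaque
      iterate-succ : ∀ {k x y} → Iterate k x → ⟦ U ⟧ next E (k ∷ x ∷ y ∷ us) → Iterate (succ k) y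
      iterate-succ {k} {x} (f , h , closed) r =
        fold (pair f f) (λ g g∈ → subst Closed (sym (∈-singleton⁻ g∈)) closed)
          (inj₂ (k , succ-spec k , x , (f , ∈-pairˡ , h) , from (class₃-spec next) r))

    opaque
      iterate-zero⁻ : ∀ {y} → Iterate ∅ y → ⟦ U ⟧ start E (y ∷ us)
      iterate-zero⁻ h with unfold h
      ... | inj₁ (_ , b) = to (class₁-spec start) b
      ... | inj₂ (j , s , _) = ⊥-elim (succ≢∅ (sym (succ-unique s)))

    opaque
      iterate-succ⁻ : ∀ {k y} → Iterate (succ k) y → ∃[ x ] (Iterate k x × ⟦ U ⟧ next E (k ∷ x ∷ y ∷ us))
      iterate-succ⁻ h with unfold h
      ... | inj₁ (empty , _) = ⊥-elim (succ≢∅ (∅-unique empty))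
      ... | inj₂ (j , s , x , i , r) with succ-injective (succ-unique s)
      ... | refl = x , i , to (class₃-spec next) r

  Transitive : C → Set ℓ
  Transitive t = ∀ u → u ∈ t → ∀ w → w ∈ u → w ∈ t

  module TransitiveHull (x : C) where
    open Iteration {0} [] (x ∷ [])
      (pairF 0F 1F 1F)
      (setF 2F ∧ all (0F ∊ 3F ⊂⊃ ex (0F ∊ 3F ∧ 1F ∊ 0F)))

    private
      E : Vec (Class U) 2
      E = Start ∷ Next ∷ []

    opaque
      total : ∀ k → Natural k → ∃[ y ] Iterate k y
      total = induction (ex (iterateF 0F 1F 1F 0F)) E []
        (pair x x , iterate-zero (pair-spec x x))
        λ k _ (y , i) → ⋃ y , iterate-succ i (⋃-set y , ⋃-spec)

    opaque
      unique : ∀ k → Natural k → ∀ y y′ → Iterate k y → Iterate k y′ → y ≡ y′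
      unique = induction (all (all (iterateF 0F 1F 2F 1F ⊃ iterateF 0F 1F 2F 0F ⊃ 1F ≐ 0F))) E []
        (λ y y′ i i′ → trans (pair-unique (iterate-zero⁻ i)) (sym (pair-unique (iterate-zero⁻ i′))))
        step
        where
        step : ∀ k → Natural k → (∀ y y′ → Iterate k y → Iterate k y′ → y ≡ y′) →
               ∀ y y′ → Iterate (succ k) y → Iterate (succ k) y′ → y ≡ y′
        step k _ ih y y′ i i′ with iterate-succ⁻ i | iterate-succ⁻ i′
        ... | z , j , s , h | z′ , j′ , s′ , h′ with ih z z′ j j′
        ... | refl = extensionality y y′ s s′ λ w → h w ⇔∘ ⇔-sym (h′ w)

    opaque
      -- The iterates are {x}, ⋃{x}, ⋃⋃{x} and so on. Replacement collects them over `ω`, and the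
      -- members of a member of one iterate lie in the next.
      transitive-hull : ∃[ t ] (x ∈ t × Transitive t)
      transitive-hull
        with replace (iterateF 0F 1F 0F 1F) E [] ω (λ k k∈ω → total k (to ω-spec k∈ω))
               (λ k y y′ k∈ω → unique k (to ω-spec k∈ω) y y′)
      ... | v , _ , h = ⋃ v ,
            from (⋃-spec _) (pair x x , from (h _) (∅ , from ω-spec natural-∅ , iterate-zero (pair-spec x x)) , ∈-pairˡ) ,
            transitive
        where
        transitive : Transitive (⋃ v)
        transitive u u∈ w w∈u with to (⋃-spec _) u∈
        ... | y , y∈v , u∈y with to (h y) y∈v
        ... | k , k∈ω , i = from (⋃-spec _)
              (⋃ y , from (h _) (succ k , from ω-spec (natural-succ (to ω-spec k∈ω)) ,
                                 iterate-succ i (⋃-set y , ⋃-spec))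
              , from (⋃-spec _) (u , u∈y , w∈u))

  open TransitiveHull using (transitive-hull) public

  opaque
    -- Foundation is about sets, whereas the counterexamples to `φ` may form a proper class. Those
    -- inside a transitive set containing `x` form a set, and by transitivity all members of a
    -- minimal one satisfy `φ`.
    ∈-induction : ∀ {m n} (φ : Fm false m (suc n)) E us →
                  (∀ x → (∀ y → y ∈ x → ⟦ U ⟧ φ E (y ∷ us)) → ⟦ U ⟧ φ E (x ∷ us)) → ∀ x → ⟦ U ⟧ φ E (x ∷ us)
    ∈-induction φ E us progressive x = byContradiction contra
      where
      contra : ¬ ¬ ⟦ U ⟧ φ E (x ∷ us)
      contra ¬p with transitive-hull x
      ... | t , x∈t , trans-t with separate (not φ) E us t
      ... | v , _ , h with foundation v (x , from (h x) (x∈t , ¬p))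
      ... | y , y∈v , minimal with to (h y) y∈v
      ... | y∈t , ¬q = ¬q (progressive y λ z z∈y → byContradiction λ ¬r →
              minimal (z , from (h z) (trans-t y y∈t z z∈y , ¬r) , z∈y))

-- Automorphisms induced by involutions of the urelements

bijectionF : ∀ {b m n} → Fin m → Fin n → Fm b m n
bijectionF g f = all (all (mapsToF (suc (suc f)) 1F 0F ⊃
  ((ur 1F ∧ ur 0F ∧ relatedF g 1F 0F) ∨
   (setF 1F ∧ setF 0F
    ∧ all (0F ∊ 2F ⊃ ex (0F ∊ 2F ∧ mapsToF (suc (suc (suc (suc f)))) 1F 0F))
    ∧ all (0F ∊ 1F ⊃ ex (0F ∊ 3F ∧ mapsToF (suc (suc (suc (suc f)))) 0F 1F))))))

imageF : ∀ {b m n} → Fin m → Fin n → Fin n → Fm b m n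
imageF g x y = ex (mapsToF 0F (suc x) (suc y) ∧ bijectionF g 0F)

module Automorphism {ℓ} (em : ExcludedMiddle ℓ) (U : Structure ℓ) (Z : ZFUR U) (collection : Collection U) where
  open Recursion em U Z collection
  open ZFUR Z

  -- An object is related to its image by a set-sized back-and-forth relation that follows `g` on
  -- urelements and matches members with members on sets. As `g` is symmetric, the extension is its
  -- own inverse; injectivity and the converse invariance statements follow from this.
  module Extension (g : Class U)
    (g-sym : ∀ {a b} → Related g a b → Related g b a)
    (g-functional : ∀ {a b b′} → Related g a b → Related g a b′ → b ≡ b′)
    (g-total : ∀ {a} → 𝒜 a → ∃[ b ] (𝒜 b × Related g a b))
    where

    private
      Forth Back : (C → C → Set ℓ) → C → C → Set ℓ
      Forth S x y = ∀ x′ → x′ ∈ x → ∃[ y′ ] (y′ ∈ y × S x′ y′)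
      Back S x y = ∀ y′ → y′ ∈ y → ∃[ x′ ] (x′ ∈ x × S x′ y′)

      Φ : (C → C → Set ℓ) → C → C → Set ℓ
      Φ S x y = (𝒜 x × 𝒜 y × Related g x y) ⊎ (IsSet U x × IsSet U y × Forth S x y × Back S x y)

      E : Vec (Class U) 1
      E = g ∷ []

      Φ-mono : ∀ {S S′ : C → C → Set ℓ} → (∀ {x y} → S x y → S′ x y) → ∀ {x y} → Φ S x y → Φ S′ x y
      Φ-mono i (inj₁ h) = inj₁ h
      Φ-mono i (inj₂ (s , s′ , forth , back)) = inj₂ (s , s′ ,
        (λ x′ x′∈ → let (y′ , y′∈ , h) = forth x′ x′∈ in y′ , y′∈ , i h) ,
        (λ y′ y′∈ → let (x′ , x′∈ , h) = back y′ y′∈ in x′ , x′∈ , i h))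

    open Corecursion Φ Φ-mono renaming (Fix to Image)

    opaque
      -- The set that `collect` provides may contain other objects besides the witnesses. Separation
      -- keeps the closed relations, since `fold` demands closedness of every member of its family.
      gather : ∀ {n} (φ : Fm false 1 (suc (suc n))) (us : Vec C n) w →
               (∀ x → x ∈ w → ∃[ f ] (Closed f × ⟦ U ⟧ φ E (x ∷ f ∷ us))) →
               ∃[ F ] ((∀ f → f ∈ F → Closed f) × (∀ x → x ∈ w → ∃[ f ] (f ∈ F × ⟦ U ⟧ φ E (x ∷ f ∷ us))))
      gather φ us w total with collect (bijectionF 0F 1F ∧ φ) E us w total
      ... | v , h with separate (bijectionF 0F 0F) E [] v
      ... | F , _ , k = F , (λ f f∈F → proj₂ (to (k f) f∈F)) ,
            λ x x∈w → let (f , f∈v , closed , p) = h x x∈w in f , from (k f) (f∈v , closed) , p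

    opaque
      image-sets : ∀ {x y} → IsSet U x → IsSet U y → Forth Image x y → Back Image x y → Image x y
      image-sets {x} {y} sx sy forth back
        with gather (ex (0F ∊ 3F ∧ mapsToF 2F 1F 0F)) (y ∷ []) x
               (λ x′ x′∈ → let (y′ , y′∈ , f , h , closed) = forth x′ x′∈ in f , closed , y′ , y′∈ , h)
           | gather (ex (0F ∊ 3F ∧ mapsToF 2F 0F 1F)) (x ∷ []) y
               (λ y′ y′∈ → let (x′ , x′∈ , f , h , closed) = back y′ y′∈ in f , closed , x′ , x′∈ , h)
      ... | F , F-closed , F-forth | G , G-closed , G-back =
        fold (F ∪ G)
          (λ f f∈ → case-∪ (∈-∪⁻ f∈))
          (inj₂ (sx , sy ,
            (λ x′ x′∈ → let (f , f∈ , y′ , y′∈ , h) = F-forth x′ x′∈ in y′ , y′∈ , f , ∈-∪ˡ f∈ , h) ,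
            (λ y′ y′∈ → let (f , f∈ , x′ , x′∈ , h) = G-back y′ y′∈ in x′ , x′∈ , f , ∈-∪ʳ f∈ , h)))
        where
        case-∪ : ∀ {f} → f ∈ F ⊎ f ∈ G → Closed f
        case-∪ (inj₁ h) = F-closed _ h
        case-∪ (inj₂ h) = G-closed _ h

    opaque
      image-urelements : ∀ {x y} → 𝒜 x → 𝒜 y → Related g x y → Image x y
      image-urelements ux uy r = fold ∅ (λ f → ⊥-elim ∘ ∉-∅) (inj₁ (ux , uy , r))

    opaque
      image-sym : ∀ x y → Image x y → Image y x
      image-sym = ∈-induction (all (imageF 0F 1F 0F ⊃ imageF 0F 0F 1F)) E [] step
        where
        step : ∀ x → (∀ x′ → x′ ∈ x → ∀ y → Image x′ y → Image y x′) → ∀ y → Image x y → Image y x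
        step x ih y h with unfold h
        ... | inj₁ (ux , uy , r) = image-urelements uy ux (g-sym r)
        ... | inj₂ (sx , sy , forth , back) = image-sets sy sx
              (λ y′ y′∈ → let (x′ , x′∈ , i) = back y′ y′∈ in x′ , x′∈ , ih x′ x′∈ y′ i)
              (λ x′ x′∈ → let (y′ , y′∈ , i) = forth x′ x′∈ in y′ , y′∈ , ih x′ x′∈ y′ i)

    opaque
      image-functional : ∀ x y y′ → Image x y → Image x y′ → y ≡ y′
      image-functional = ∈-induction (all (all (imageF 0F 2F 1F ⊃ imageF 0F 2F 0F ⊃ 1F ≐ 0F))) E [] step
        where
        half : ∀ {x y y′} → (∀ x′ → x′ ∈ x → ∀ y y′ → Image x′ y → Image x′ y′ → y ≡ y′) →
               Back Image x y → Forth Image x y′ → ∀ z → z ∈ y → z ∈ y′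
        half {y′ = y′} ih back forth z z∈ with back z z∈
        ... | x′ , x′∈ , i with forth x′ x′∈
        ... | w , w∈ , j = subst (_∈ y′) (ih x′ x′∈ w z j i) w∈
        step : ∀ x → (∀ x′ → x′ ∈ x → ∀ y y′ → Image x′ y → Image x′ y′ → y ≡ y′) →
               ∀ y y′ → Image x y → Image x y′ → y ≡ y′
        step x ih y y′ h h′ with unfold h | unfold h′
        ... | inj₁ (_ , _ , r) | inj₁ (_ , _ , r′) = g-functional r r′
        ... | inj₁ (ux , _)    | inj₂ (sx , _)     = ⊥-elim (sx ux)
        ... | inj₂ (sx , _)    | inj₁ (ux , _)     = ⊥-elim (sx ux)
        ... | inj₂ (_ , sy , forth , back) | inj₂ (_ , sy′ , forth′ , back′) =
              extensionality y y′ sy sy′ λ z → mk⇔ (half ih back forth′ z) (half ih back′ forth z)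

    opaque
      image-total : ∀ x → ∃[ y ] Image x y
      image-total = ∈-induction (ex (imageF 0F 1F 0F)) E [] step
        where
        step : ∀ x → (∀ x′ → x′ ∈ x → ∃[ y ] Image x′ y) → ∃[ y ] Image x y
        step x ih with em {𝒜 x}
        ... | yes ux = let (b , ub , r) = g-total ux in b , image-urelements ux ub r
        ... | no sx with replace (imageF 0F 0F 1F) E [] x ih (λ x′ y y′ _ → image-functional x′ y y′)
        ... | y , sy , h = y , image-sets sx sy
                (λ x′ x′∈ → let (y′ , i) = ih x′ x′∈ in y′ , from (h y′) (x′ , x′∈ , i) , i)
                (λ y′ → to (h y′))

    opaque
      extend : C → C
      extend x = proj₁ (image-total x)
      extend-spec : ∀ x → Image x (extend x)
      extend-spec x = proj₂ (image-total x)

    opaque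
      extend-unique : ∀ {x y} → Image x y → extend x ≡ y
      extend-unique = image-functional _ _ _ (extend-spec _)

    opaque
      extend-involutive : ∀ x → extend (extend x) ≡ x
      extend-involutive x = extend-unique (image-sym _ _ (extend-spec x))

    opaque
      extend-∈ : ∀ {x y} → x ∈ y → extend x ∈ extend y
      extend-∈ {x} {y} x∈y with unfold (extend-spec y)
      ... | inj₁ (uy , _) = ⊥-elim (member⇒set x∈y uy)
      ... | inj₂ (_ , _ , forth , _) with forth x x∈y
      ... | z , z∈ , i = subst (_∈ extend y) (sym (extend-unique i)) z∈

    opaque
      extend-𝒜 : ∀ {x} → 𝒜 x → 𝒜 (extend x)
      extend-𝒜 {x} ux with unfold (extend-spec x)
      ... | inj₁ (_ , uy , _) = uy
      ... | inj₂ (sx , _)     = ⊥-elim (sx ux)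

    opaque
      extend-urelement : ∀ {a b} → 𝒜 a → Related g a b → extend a ≡ b
      extend-urelement {a} ua r with unfold (extend-spec a)
      ... | inj₁ (_ , _ , r′) = g-functional r′ r
      ... | inj₂ (sa , _)     = ⊥-elim (sa ua)

    opaque
      -- ∈-induction that stays within `t` by transitivity. It serves twice: with `t₀` for the
      -- parameter of the abstraction map, and with the hull for its value at `X`.
      extend-fixes : ∀ {t} → Transitive t → (∀ a → a ∈ t → 𝒜 a → Related g a a) → ∀ x → x ∈ t → extend x ≡ x
      extend-fixes {t} trans-t fixed x x∈t =
        extend-unique (∈-induction (0F ∊ 1F ⊃ imageF 0F 0F 0F) E (t ∷ []) step x x∈t)
        where
        step : ∀ x → (∀ x′ → x′ ∈ x → x′ ∈ t → Image x′ x′) → x ∈ t → Image x x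
        step x ih x∈t with em {𝒜 x}
        ... | yes ux = image-urelements ux ux (fixed x x∈t ux)
        ... | no sx  = image-sets sx sx (λ x′ x′∈ → x′ , x′∈ , ih x′ x′∈ (trans-t x x∈t x′ x′∈))
                                        (λ x′ x′∈ → x′ , x′∈ , ih x′ x′∈ (trans-t x x∈t x′ x′∈))

    opaque
      extend-∈⁻ : ∀ {x y} → extend x ∈ extend y → x ∈ y
      extend-∈⁻ {x} {y} h = subst (_∈ y) (extend-involutive x) (subst (_ ∈_) (extend-involutive y) (extend-∈ h))

    opaque
      extend-𝒜⁻ : ∀ {x} → 𝒜 (extend x) → 𝒜 x
      extend-𝒜⁻ {x} h = subst 𝒜 (extend-involutive x) (extend-𝒜 h)

    opaque
      extend-injective : ∀ {x y} → extend x ≡ extend y → x ≡ y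
      extend-injective {x} {y} eq = trans (sym (extend-involutive x)) (trans (cong extend eq) (extend-involutive y))

    -- The image of a class under the automorphism: satisfaction is invariant, so only the parameter
    -- has to move.
    extendᶜ : Class U → Class U
    extendᶜ (ψ , z) = ψ , extend z

    opaque
      sat-invariant : ∀ {n} (φ : Formula n) e → Sat U φ e ⇔ Sat U φ (map extend e)
      sat-invariant (i ∈′ j) e rewrite lookup-map i extend e | lookup-map j extend e = mk⇔ extend-∈ extend-∈⁻
      sat-invariant (i ≈′ j) e rewrite lookup-map i extend e | lookup-map j extend e = mk⇔ (cong extend) extend-injective
      sat-invariant (𝒜′ i) e rewrite lookup-map i extend e = mk⇔ extend-𝒜 extend-𝒜⁻
      sat-invariant ⊥′ e = ⇔-refl
      sat-invariant (φ ⇒ ψ) e = →-cong-⇔ (sat-invariant φ e) (sat-invariant ψ e)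
      sat-invariant (∀′ φ) e = mk⇔
        (λ h x → subst (λ y → Sat U φ (y ∷ map extend e)) (extend-involutive x)
                   (to (sat-invariant φ (extend x ∷ e)) (h (extend x))))
        (λ h x → from (sat-invariant φ (x ∷ e)) (h (extend x)))

    opaque
      sat₂-invariant : ∀ {m n} (φ : Formula₂ m n) X e → Sat₂ U φ X e ⇔ Sat₂ U φ (map extendᶜ X) (map extend e)
      sat₂-invariant (i ∈′ j) X e rewrite lookup-map i extend e | lookup-map j extend e = mk⇔ extend-∈ extend-∈⁻
      sat₂-invariant (i ≈′ j) X e rewrite lookup-map i extend e | lookup-map j extend e = mk⇔ (cong extend) extend-injective
      sat₂-invariant (i ∈ᶜ j) X e rewrite lookup-map i extend e | lookup-map j extendᶜ X =
        sat-invariant (proj₁ (lookup X j)) (lookup e i ∷ proj₂ (lookup X j) ∷ [])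
      sat₂-invariant (𝒜′ i) X e rewrite lookup-map i extend e = mk⇔ extend-𝒜 extend-𝒜⁻
      sat₂-invariant ⊥′ X e = ⇔-refl
      sat₂-invariant (φ ⇒ ψ) X e = →-cong-⇔ (sat₂-invariant φ X e) (sat₂-invariant ψ X e)
      sat₂-invariant (∀′ φ) X e = mk⇔
        (λ h x → subst (λ y → Sat₂ U φ (map extendᶜ X) (y ∷ map extend e)) (extend-involutive x)
                   (to (sat₂-invariant φ X (extend x ∷ e)) (h (extend x))))
        (λ h x → from (sat₂-invariant φ X (x ∷ e)) (h (extend x)))
      sat₂-invariant (∀ᶜ φ) X e = mk⇔
        (λ { h (ψ , z) → subst (λ y → Sat₂ U φ ((ψ , y) ∷ map extendᶜ X) (map extend e)) (extend-involutive z)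
                   (to (sat₂-invariant φ ((ψ , extend z) ∷ X) e) (h (ψ , extend z))) })
        (λ h Y → from (sat₂-invariant φ (Y ∷ X) e) (h (extendᶜ Y)))

-- From countable choice to an injective sequence of urelements

newF : ∀ {b m n} → Fin n → Fin n → Fm b m n
newF y a = all (not (mapsToF (suc y) 0F (suc a)))

firstNewF : ∀ {b m n} → Fin n → Fin n → Fin n → Fin n → Fm b m n
firstNewF c k y a = ex (successorF 0F (suc k) ∧ ex (mapsToF (suc (suc c)) 1F 0F ∧
  ex (mapsToF 1F 0F (suc (suc (suc a))) ∧ newF (suc (suc (suc y))) (suc (suc (suc a)))
    ∧ all (0F ∊ 1F ⊃ all (mapsToF 3F 1F 0F ⊃ not (newF (suc (suc (suc (suc (suc y))))) 0F))))))

fiberF : ∀ {b m n} → Fin m → Fin n → Fin n → Fin n → Fm b m n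
fiberF Q v k w = setF w ∧ all (0F ∊ suc w ⊂⊃
  ex (0F ∊ suc (suc v) ∧ orderedPairF 1F (suc (suc k)) 0F ∧ relatedF Q (suc (suc k)) 0F))

module Choice {ℓ} (em : ExcludedMiddle ℓ) (U : Structure ℓ) (Z : ZFUR U) (collection : Collection U) (acω : ACω U) where
  open Recursion em U Z collection
  open ZFUR Z

  -- Collection first bounds the class of possible values by a set v; ACω is then applied to the
  -- fibers {k} × {s ∈ v ∣ Q k s}, which are pairwise disjoint.
  module _ (Q : Class U) (Q-total : ∀ k → Natural k → ∃[ s ] Related Q k s) where

    private
      opaque
        bound : ∃[ v ] (∀ k → k ∈ ω → ∃[ s ] (s ∈ v × Related Q k s))
        bound = collect (relatedF 0F 0F 1F) (Q ∷ []) [] ω λ k k∈ω → Q-total k (to ω-spec k∈ω)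

      v : C
      v = proj₁ bound

      Fiber : C → C → Set ℓ
      Fiber k w = IsSet U w × (∀ p → (p ∈ w) ⇔ (∃[ s ] (s ∈ v × IsOrderedPair U p k s × Related Q k s)))

      opaque
        fiber : ∀ k → ∃[ w ] Fiber k w
        fiber k with separate (relatedF 0F 1F 0F) (Q ∷ []) (k ∷ []) v
        ... | v′ , _ , h
          with replace {m = 0} (orderedPairF 1F 2F 0F) [] (k ∷ []) v′
                 (λ s _ → ⟪ k , s ⟫ , ordered-pair k s)
                 (λ s p p′ _ o o′ → trans (ordered-pair-unique o) (sym (ordered-pair-unique o′)))
        ... | w , set , h′ = w , set , λ p → h′ p ⇔∘
                mk⇔ (λ (s , s∈ , o) → s , proj₁ (to (h s) s∈) , o , proj₂ (to (h s) s∈))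
                    (λ (s , s∈ , o , r) → s , from (h s) (s∈ , r) , o)

      opaque
        fiber-unique : ∀ {k w w′} → Fiber k w → Fiber k w′ → w ≡ w′
        fiber-unique (s , h) (s′ , h′) = extensionality _ _ s s′ λ p → h p ⇔∘ ⇔-sym (h′ p)

      opaque
        fiber-inhabited : ∀ {k w} → Natural k → Fiber k w → ∃[ s ] ⟪ k , s ⟫ ∈ w
        fiber-inhabited {k} nat (_ , h) with proj₂ bound k (from ω-spec nat)
        ... | s , s∈v , r = s , from (h _) (s , s∈v , ordered-pair k s , r)

      opaque
        fiber-index : ∀ {k k′ w s} → Fiber k w → ⟪ k′ , s ⟫ ∈ w → k ≡ k′
        fiber-index (_ , h) p∈ with to (h _) p∈
        ... | _ , _ , o , _ = sym (proj₁ (⟪⟫-injective (ordered-pair-unique o)))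

      opaque
        family : ∃[ W ] (IsSet U W × (∀ w → (w ∈ W) ⇔ (∃[ k ] (k ∈ ω × Fiber k w))))
        family = replace (fiberF 0F 2F 0F 1F) (Q ∷ []) (v ∷ []) ω
                   (λ k _ → fiber k) (λ k w w′ _ → fiber-unique)

      W : C
      W = proj₁ family

      opaque
        W-spec : ∀ {w} → w ∈ W → ∃[ k ] (Natural k × Fiber k w)
        W-spec {w} w∈ with to (proj₂ (proj₂ family) w) w∈
        ... | k , k∈ω , h = k , to ω-spec k∈ω , h

      opaque
        -- The index can be read off from any element of a fiber. Empty fibers would all coincide,
        -- so this rests on `Q-total`.
        index-unique : ∀ {k k′ w} → Natural k → Fiber k w → Fiber k′ w → k ≡ k′
        index-unique nat h h′ with fiber-inhabited nat h
        ... | s , p∈ = sym (fiber-index h′ p∈)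

      opaque
        index : ∃[ f ] (IsSet U f × (∀ p → (p ∈ f) ⇔
                  (∃[ w ] (w ∈ W × ∃[ k ] (Natural k × Fiber k w × IsOrderedPair U p w k)))))
        index = replace (ex (naturalF 0F ∧ fiberF 0F 3F 0F 1F ∧ orderedPairF 2F 1F 0F)) (Q ∷ []) (v ∷ []) W
          (λ w w∈ → let (k , nat , h) = W-spec w∈ in ⟪ w , k ⟫ , k , nat , h , ordered-pair w k)
          unique
          where
          unique : ∀ w p p′ → w ∈ W → ∃[ k ] (Natural k × Fiber k w × IsOrderedPair U p w k) →
                   ∃[ k ] (Natural k × Fiber k w × IsOrderedPair U p′ w k) → p ≡ p′
          unique w p p′ _ (k , nat , h , o) (k′ , _ , h′ , o′) with index-unique nat h h′
          ... | refl = trans (ordered-pair-unique o) (sym (ordered-pair-unique o′))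

      f : C
      f = proj₁ index

      opaque
        f-spec : ∀ {w k} → MapsTo U f w k → Natural k × Fiber k w
        f-spec m with to (proj₂ (proj₂ index) _) (mapsTo⇒∈ m)
        ... | _ , _ , _ , nat , h , o with ⟪⟫-injective (ordered-pair-unique o)
        ... | refl , refl = nat , h

      opaque
        W-countable : IsCountable U W
        W-countable = f , (proj₁ (proj₂ index) , domain , functional) , (λ w k m → proj₁ (f-spec m)) ,
                      λ w w′ k m m′ → fiber-unique (proj₂ (f-spec m)) (proj₂ (f-spec m′))
          where
          domain : ∀ p → p ∈ f → ∃[ w ] ∃[ k ] (w ∈ W × IsOrderedPair U p w k)
          domain p p∈ with to (proj₂ (proj₂ index) p) p∈
          ... | w , w∈ , k , _ , _ , o = w , k , w∈ , o
          functional : ∀ w → w ∈ W → ∃! _≡_ (MapsTo U f w)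
          functional w w∈ with W-spec w∈
          ... | k , nat , h = k , (⟪ w , k ⟫ , from (proj₂ (proj₂ index) _) (w , w∈ , k , nat , h , o) , o) ,
                λ m → index-unique nat h (proj₂ (f-spec m))
            where o : IsOrderedPair U ⟪ w , k ⟫ w k
                  o = ordered-pair w k

      opaque
        choice : ∃[ F ] IsChoiceFunctionOn U F W
        choice = acω W (proj₁ (proj₂ family)) W-countable
          λ w w∈ → let (k , nat , h) = W-spec w∈ ; (s , p∈) = fiber-inhabited nat h in ⟪ k , s ⟫ , p∈

    opaque
      countable-choice : ∃[ c ] ((∀ k → Natural k → ∃[ s ] (MapsTo U c k s × Related Q k s)) ×
                                 (∀ k s s′ → MapsTo U c k s → MapsTo U c k s′ → s ≡ s′))
      countable-choice with choice
      -- The value of `F` at the `k`-th fiber is itself a pair with first component `k`, so the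
      -- range of `F` already is the wanted function.
      ... | F , (F-set , F-domain , F-function) , F-chooses
        with separate {m = 0} (ex (mapsToF 2F 0F 1F)) [] (F ∷ []) (⋃ W)
      ... | c , _ , h = c , total , functional
        where
        chosen : ∀ {w p} → MapsTo U F w p → w ∈ W × p ∈ w
        chosen {w} {p} m@(q , q∈ , o) with F-domain q q∈
        ... | w′ , p′ , w∈ , o′ with ⟪⟫-injective (trans (sym (ordered-pair-unique o)) (ordered-pair-unique o′))
        ... | refl , refl = w∈ , F-chooses w p m
        total : ∀ k → Natural k → ∃[ s ] (MapsTo U c k s × Related Q k s)
        total k nat with fiber k
        ... | w , hw with F-function w (from (proj₂ (proj₂ family) w) (k , from ω-spec nat , hw))
        ... | p , m , _ with chosen m
        ... | w∈ , p∈ with to (proj₂ hw p) p∈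
        ... | s , _ , o , r = s , (p , from (h p) (from (⋃-spec p) (w , w∈ , p∈) , w , m) , o) , r
        functional : ∀ k s s′ → MapsTo U c k s → MapsTo U c k s′ → s ≡ s′
        functional k s s′ m m′ with proj₂ (to (h _) (mapsTo⇒∈ m)) | proj₂ (to (h _) (mapsTo⇒∈ m′))
        ... | w , n | w′ , n′ with chosen n | chosen n′
        ... | w∈ , p∈ | w′∈ , p′∈ with W-spec w∈ | W-spec w′∈
        ... | j , _ , hw | j′ , _ , hw′ with fiber-index hw p∈ | fiber-index hw′ p′∈
        ... | refl | refl with fiber-unique hw hw′
        ... | refl with F-function w w∈
        ... | p , _ , unique = proj₂ (⟪⟫-injective (trans (sym (unique n)) (unique n′)))

module Enumeration {ℓ} (em : ExcludedMiddle ℓ) (U : Structure ℓ) (Z : ZFUR U) (collection : Collection U) (acω : ACω U)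
                   (proper : ¬ UrelementsFormSet U) where
  open Recursion em U Z collection
  open Choice em U Z collection acω using (countable-choice)
  open ZFUR Z

  opaque
    -- If `w` contained every urelement, Separation from `w` would make the urelements a set.
    fresh : ∀ w → ∃[ a ] (𝒜 a × ¬ a ∈ w)
    fresh w = byContradiction λ none → let (s , set , h) = separate {m = 0} (ur 0F) [] [] w in
      proper (s , set , λ x → mk⇔ (λ x∈ → proj₂ (to (h x) x∈))
        (λ ux → from (h x) (byContradiction (λ x∉ → none (x , ux , x∉)) , ux)))

  New : C → C → Set ℓ
  New y a = ∀ i → ¬ MapsTo U y i a

  -- Any set may start the iteration, so AtLeast k d bounds the size of d from below only.
  module Size where
    open Iteration {0} [] [] (0F ≐ 0F)
      (ex (not (0F ∊ 2F) ∧ all (0F ∊ 4F ⊂⊃ (0F ∊ 3F ∨ 0F ≐ 1F))))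
      renaming (Iterate to AtLeast) public

    E : Vec (Class U) 2
    E = Start ∷ Next ∷ []

    opaque
      at-least-adjoin : ∀ {k d a} → AtLeast k d → ¬ a ∈ d → AtLeast (succ k) (adjoin d a)
      at-least-adjoin h a∉ = iterate-succ h (_ , a∉ , adjoin-spec)

    opaque
      -- Either the element adjoined last is `b`, and the set before it serves, or `b` is removed
      -- from that set and the last element is adjoined again. The successor appears as a variable
      -- `s` because formulas have no function symbols.
      at-least-remove : ∀ k → Natural k → ∀ d b → ∃[ s ] (IsSuccessor U s k × AtLeast s d) →
                        ∃[ d′ ] (AtLeast k d′ × (∀ z → z ∈ d′ → z ∈ d × ¬ z ≡ b))
      at-least-remove = induction
        (all (all (ex (successorF 0F 3F ∧ iterateF 0F 1F 0F 2F) ⊃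
          ex (iterateF 0F 1F 3F 0F ∧ all (0F ∊ 1F ⊃ (0F ∊ 3F ∧ not (0F ≐ 2F))))))) E []
        (λ d b _ → ∅ , iterate-zero refl , λ z → ⊥-elim ∘ ∉-∅) step
        where
        Reduct : C → C → C → Set ℓ
        Reduct k d b = ∃[ d′ ] (AtLeast k d′ × (∀ z → z ∈ d′ → z ∈ d × ¬ z ≡ b))
        step : ∀ k → Natural k → (∀ d b → ∃[ s ] (IsSuccessor U s k × AtLeast s d) → Reduct k d b) →
               ∀ d b → ∃[ s ] (IsSuccessor U s (succ k) × AtLeast s d) → Reduct (succ k) d b
        step k nat ih d b (s , hs , h) with succ-unique hs
        ... | refl with iterate-succ⁻ h
        ... | d₁ , h₁ , a , a∉ , d-spec with em {a ≡ b}
        ... | yes refl = d₁ , h₁ , λ z z∈ → from (d-spec z) (inj₁ z∈) , λ { refl → a∉ z∈ }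
        ... | no a≢b with ih d₁ b (succ k , succ-spec k , h₁)
        ... | d₂ , h₂ , sub = adjoin d₂ a , at-least-adjoin h₂ (λ a∈ → a∉ (proj₁ (sub a a∈))) , sub′
          where
          sub′ : ∀ z → z ∈ adjoin d₂ a → z ∈ d × ¬ z ≡ b
          sub′ z z∈ with to (adjoin-spec z) z∈
          ... | inj₁ z∈d₂ = from (d-spec z) (inj₁ (proj₁ (sub z z∈d₂))) , proj₂ (sub z z∈d₂)
          ... | inj₂ refl = from (d-spec z) (inj₂ refl) , a≢b

  open Size using (AtLeast; at-least-adjoin; at-least-remove)

  module FiniteSequences (w : C) where
    open Iteration {0} [] (w ∷ [])
      (emptyF 0F)
      (ex (ur 0F ∧ not (0F ∊ 4F) ∧ newF 2F 0F ∧ extendsF 3F 2F 1F 0F))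
      renaming (Iterate to Sequence) public

    E : Vec (Class U) 2
    E = Start ∷ Next ∷ []

    private
      opaque
        range-of-empty : ∀ {y i a} → IsEmptySet U y → ¬ MapsTo U y i a
        range-of-empty (_ , none) m = none _ (mapsTo⇒∈ m)

    opaque
      sequence-exists : ∀ k → Natural k → ∃[ s ] Sequence k s
      sequence-exists = induction (ex (iterateF 0F 1F 1F 0F)) E [] (∅ , iterate-zero ∅-empty) step
        where
        step : ∀ k → Natural k → ∃[ s ] Sequence k s → ∃[ s ] Sequence (succ k) s
        step k _ (s , h) with fresh (w ∪ ⋃ (⋃ s))
        ... | a , ua , a∉ = _ , iterate-succ h
                (a , ua , (λ a∈ → a∉ (∈-∪ˡ a∈)) , (λ i m → a∉ (∈-∪ʳ (mapsTo-⋃⋃ m))) , extends-adjoin s k a)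

    opaque
      sequence-facts : ∀ k → Natural k → ∀ s → Sequence k s → ∀ i a → MapsTo U s i a →
                       i ∈ k × (𝒜 a × ¬ a ∈ w) × (∀ b → MapsTo U s i b → b ≡ a)
      sequence-facts = induction
        (all (iterateF 0F 1F 1F 0F ⊃ all (all (mapsToF 2F 1F 0F ⊃
          (1F ∊ 3F ∧ (ur 0F ∧ not (0F ∊ 4F)) ∧ all (mapsToF 3F 2F 0F ⊃ 0F ≐ 1F)))))) E (w ∷ [])
        (λ s h i a m → ⊥-elim (range-of-empty (iterate-zero⁻ h) m)) step
        where
        Facts : C → C → C → C → Set ℓ
        Facts k s i a = i ∈ k × (𝒜 a × ¬ a ∈ w) × (∀ b → MapsTo U s i b → b ≡ a)
        step : ∀ k → Natural k → (∀ s → Sequence k s → ∀ i a → MapsTo U s i a → Facts k s i a) →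
               ∀ s → Sequence (succ k) s → ∀ i a → MapsTo U s i a → Facts (succ k) s i a
        step k _ ih s h i a m with iterate-succ⁻ h
        ... | y , hy , c , uc , c∉ , _ , ext with extends⁻ ext m
        ... | inj₁ m′ = let (i∈ , ua , unique) = ih y hy i a m′ in ∈-∪ˡ i∈ , ua , λ b n → old unique i∈ (extends⁻ ext n)
          where
          old : (∀ b → MapsTo U y i b → b ≡ a) → i ∈ k → ∀ {b} → MapsTo U y i b ⊎ (i ≡ k × b ≡ c) → b ≡ a
          old unique i∈ (inj₁ n) = unique _ n
          old unique i∈ (inj₂ (refl , _)) = ⊥-elim (∉-refl i∈)
        ... | inj₂ (refl , refl) = ∈-succ , (uc , c∉) , λ b n → new (extends⁻ ext n)
          where
          new : ∀ {b} → MapsTo U y i b ⊎ (i ≡ i × b ≡ a) → b ≡ a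
          new (inj₁ n) = ⊥-elim (∉-refl (proj₁ (ih y hy i _ n)))
          new (inj₂ (_ , e)) = e

    opaque
      sequence-range-large : ∀ k → Natural k → ∀ s → Sequence k s →
                             ∃[ d ] (AtLeast k d × (∀ a → a ∈ d → ∃[ i ] MapsTo U s i a))
      sequence-range-large = induction
        (all (iterateF 0F 1F 1F 0F ⊃ ex (iterateF 2F 3F 2F 0F ∧ all (0F ∊ 1F ⊃ ex (mapsToF 3F 0F 1F)))))
        (Start ∷ Next ∷ Size.E) [] (λ s _ → ∅ , Size.iterate-zero refl , λ a → ⊥-elim ∘ ∉-∅) step
        where
        Large : C → C → Set ℓ
        Large k s = ∃[ d ] (AtLeast k d × (∀ a → a ∈ d → ∃[ i ] MapsTo U s i a))
        step : ∀ k → Natural k → (∀ s → Sequence k s → Large k s) → ∀ s → Sequence (succ k) s → Large (succ k) s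
        step k _ ih s h with iterate-succ⁻ h
        ... | y , hy , c , _ , _ , new , ext with ih y hy
        ... | d , hd , sub = adjoin d c , at-least-adjoin hd (λ c∈ → let (i , m) = sub c c∈ in new i m) , sub′
          where
          sub′ : ∀ a → a ∈ adjoin d c → ∃[ i ] MapsTo U s i a
          sub′ a a∈ with to (adjoin-spec a) a∈
          ... | inj₁ a∈d  = let (i , m) = sub a a∈d in i , extends-old ext m
          ... | inj₂ refl = k , extends-new ext

    opaque
      sequences-sig : ∃[ c ] ((∀ k → Natural k → ∃[ s ] (MapsTo U c k s × Sequence k s)) ×
                              (∀ k s s′ → MapsTo U c k s → MapsTo U c k s′ → s ≡ s′))
      sequences-sig with countable-choice (class₂ (iterateF 0F 1F 0F 1F) E [])
                           (λ k nat → let (s , h) = sequence-exists k nat in s , from (class₂-spec (iterateF 0F 1F 0F 1F)) h)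
      ... | c , total , functional = c ,
            (λ k nat → let (s , m , r) = total k nat in s , m , to (class₂-spec (iterateF 0F 1F 0F 1F)) r) , functional

    opaque
      sequences : C
      sequences = proj₁ sequences-sig
      sequences-total : ∀ k → Natural k → ∃[ s ] (MapsTo U sequences k s × Sequence k s)
      sequences-total = proj₁ (proj₂ sequences-sig)
      sequences-functional : ∀ k s s′ → MapsTo U sequences k s → MapsTo U sequences k s′ → s ≡ s′
      sequences-functional = proj₂ (proj₂ sequences-sig)

  -- Concatenating the chosen finite sequences without repetition: the k-th value is the first entry of
  -- the (k + 1)-st sequence that is different from the k values before it.
  module Greedy (w : C) where
    open FiniteSequences w hiding (E; Start; Next) renaming (Closed to Closed′)

    FirstNew : C → C → C → Set ℓ
    FirstNew k y a = ⟦ U ⟧ (firstNewF {false} {0} 0F 1F 2F 3F) [] (sequences ∷ k ∷ y ∷ a ∷ [])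

    module I = Iteration {0} [] (sequences ∷ [])
      (emptyF 0F)
      (ex (firstNewF 4F 1F 2F 0F ∧ extendsF 3F 2F 1F 0F))
    open I using () renaming (Iterate to Initial) public

    E : Vec (Class U) 2
    E = I.Start ∷ I.Next ∷ []

    opaque
      first-new-is-new : ∀ {k y a} → FirstNew k y a → New y a
      first-new-is-new (_ , _ , _ , _ , _ , _ , new , _) = new

    opaque
      first-new-range : ∀ {k y a} → Natural k → FirstNew k y a → 𝒜 a × ¬ a ∈ w
      first-new-range {k} nat (_ , hk , s , ms , i , m , _) with succ-unique hk
      ... | refl with sequences-total (succ k) (natural-succ nat)
      ... | s′ , ms′ , h with sequences-functional _ _ _ ms ms′
      ... | refl = proj₁ (proj₂ (sequence-facts _ (natural-succ nat) s h i _ m))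

    opaque
      first-new-unique : ∀ {k y a a′} → Natural k → FirstNew k y a → FirstNew k y a′ → a ≡ a′
      first-new-unique {k} nat (_ , hk , s , ms , i , m , new , min) (_ , hk′ , s′ , ms′ , i′ , m′ , new′ , min′)
        with succ-unique hk | succ-unique hk′
      ... | refl | refl with sequences-functional _ _ _ ms ms′ | sequences-total (succ k) (natural-succ nat)
      ... | refl | s₁ , ms₁ , h with sequences-functional _ _ _ ms ms₁
      ... | refl with sequence-facts _ (natural-succ nat) s h i _ m | sequence-facts _ (natural-succ nat) s h i′ _ m′
      ... | i∈ , _ , _ | i′∈ , _ , unique
        with trichotomy i (natural-∈ _ (natural-succ nat) i i∈) i′ (natural-∈ _ (natural-succ nat) i′ i′∈)
      ... | inj₁ i∈i′        = ⊥-elim (min′ i i∈i′ _ m new)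
      ... | inj₂ (inj₁ refl) = unique _ m
      ... | inj₂ (inj₂ i′∈i) = ⊥-elim (min i′ i′∈i _ m′ new′)

    opaque
      -- Induction on the length of the segment `y`: its last value is removed from `d`, which
      -- lowers the size bound by one, and the hypothesis applies to the shorter segment.
      pigeonhole : ∀ k → Natural k → ∀ y → Initial k y → ∀ d s → IsSuccessor U s k → AtLeast s d → ∃[ a ] (a ∈ d × New y a)
      pigeonhole = induction
        (all (iterateF 0F 1F 1F 0F ⊃ all (all (successorF 0F 3F ⊃ iterateF 2F 3F 0F 1F ⊃ ex (0F ∊ 2F ∧ newF 3F 0F)))))
        (I.Start ∷ I.Next ∷ Size.E) [] base step
        where
        base : ∀ y → Initial ∅ y → ∀ d s → IsSuccessor U s ∅ → AtLeast s d → ∃[ a ] (a ∈ d × New y a)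
        base y hy d s hs hd with succ-unique hs
        ... | refl with Size.iterate-succ⁻ hd
        ... | d₁ , _ , a , _ , d-spec = a , from (d-spec a) (inj₂ refl) ,
              λ i m → proj₂ (I.iterate-zero⁻ hy) _ (mapsTo⇒∈ m)
        step : ∀ k → Natural k →
               (∀ y → Initial k y → ∀ d s → IsSuccessor U s k → AtLeast s d → ∃[ a ] (a ∈ d × New y a)) →
               ∀ y → Initial (succ k) y → ∀ d s → IsSuccessor U s (succ k) → AtLeast s d → ∃[ a ] (a ∈ d × New y a)
        step k nat ih y hy d s hs hd with succ-unique hs
        ... | refl with I.iterate-succ⁻ hy
        ... | y₁ , hy₁ , a , _ , ext with at-least-remove (succ k) (natural-succ nat) d a (_ , succ-spec _ , hd)
        ... | d₁ , hd₁ , sub with ih y₁ hy₁ d₁ _ (succ-spec k) hd₁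
        ... | b , b∈ , new = b , proj₁ (sub b b∈) , new′
          where
          new′ : New y b
          new′ i m with extends⁻ ext m
          ... | inj₁ m′ = new i m′
          ... | inj₂ (_ , e) = proj₂ (sub b b∈) e

    opaque
      first-new-exists : ∀ {k y} → Natural k → Initial k y → ∃[ a ] FirstNew k y a
      first-new-exists {k} {y} nat hy with sequences-total (succ k) (natural-succ nat)
      ... | s , ms , h with sequence-range-large _ (natural-succ nat) s h
      ... | d , hd , sub with pigeonhole k nat y hy d _ (succ-spec k) hd
      ... | b , b∈ , new with sub b b∈
      ... | j , m with sequence-facts _ (natural-succ nat) s h j b m
      ... | j∈ , _ with least-natural {m = 0} (ex (mapsToF 2F 1F 0F ∧ newF 3F 0F)) [] (s ∷ y ∷ []) j
                          (natural-∈ _ (natural-succ nat) j j∈) (b , m , new)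
      ... | i , _ , (a , m′ , new′) , min =
            a , succ k , succ-spec k , s , ms , i , m′ , new′ , λ j j∈i c mc newc → min j j∈i (c , mc , newc)

    opaque
      initial-exists : ∀ k → Natural k → ∃[ y ] Initial k y
      initial-exists = induction (ex (iterateF 0F 1F 1F 0F)) E [] (∅ , I.iterate-zero ∅-empty)
        λ k nat (y , hy) → let (a , f) = first-new-exists nat hy in _ , I.iterate-succ hy (a , f , extends-adjoin y k a)

    opaque
      initial-unique : ∀ k → Natural k → ∀ y y′ → Initial k y → Initial k y′ → y ≡ y′
      initial-unique = induction (all (all (iterateF 0F 1F 2F 1F ⊃ iterateF 0F 1F 2F 0F ⊃ 1F ≐ 0F))) E []
        (λ y y′ h h′ → trans (∅-unique (I.iterate-zero⁻ h)) (sym (∅-unique (I.iterate-zero⁻ h′)))) step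
        where
        step : ∀ k → Natural k → (∀ y y′ → Initial k y → Initial k y′ → y ≡ y′) →
               ∀ y y′ → Initial (succ k) y → Initial (succ k) y′ → y ≡ y′
        step k nat ih y y′ h h′ with I.iterate-succ⁻ h | I.iterate-succ⁻ h′
        ... | y₁ , h₁ , a , f , ext | y₁′ , h₁′ , a′ , f′ , ext′ with ih y₁ y₁′ h₁ h₁′
        ... | refl with first-new-unique nat f f′
        ... | refl = extends-unique ext ext′

    Value : C → C → Set ℓ
    Value k a = ∃[ y ] (Initial k y × FirstNew k y a)

    opaque
      value-unique : ∀ {k a a′} → Natural k → Value k a → Value k a′ → a ≡ a′
      value-unique {k} nat (y , h , f) (y′ , h′ , f′) with initial-unique k nat y y′ h h′
      ... | refl = first-new-unique nat f f′

    opaque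
      value-persists : ∀ {i a} → Value i a → ∀ k → Natural k → i ∈ k → ∀ y → Initial k y → MapsTo U y i a
      value-persists {i} {a} v = induction (1F ∊ 0F ⊃ all (iterateF 0F 1F 1F 0F ⊃ mapsToF 0F 2F 3F)) E (i ∷ a ∷ [])
        (⊥-elim ∘ ∉-∅) step
        where
        step : ∀ k → Natural k → (i ∈ k → ∀ y → Initial k y → MapsTo U y i a) →
               i ∈ succ k → ∀ y → Initial (succ k) y → MapsTo U y i a
        step k nat ih i∈ y h with I.iterate-succ⁻ h
        ... | y₁ , h₁ , b , f , ext with to (adjoin-spec i) i∈
        ... | inj₁ i∈k  = extends-old ext (ih i∈k y₁ h₁)
        ... | inj₂ refl = subst (MapsTo U y i) (value-unique nat (y₁ , h₁ , f) v) (extends-new ext)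

    opaque
      -- By `value-persists` a value stays in all later segments, while each value is new with
      -- respect to the segment it extends.
      value-injective : ∀ {i j a} → Natural i → Natural j → Value i a → Value j a → i ≡ j
      value-injective {i} {j} ni nj v@(y , h , f) v′@(y′ , h′ , f′) with trichotomy i ni j nj
      ... | inj₁ i∈j        = ⊥-elim (first-new-is-new f′ i (value-persists v j nj i∈j y′ h′))
      ... | inj₂ (inj₁ e)   = e
      ... | inj₂ (inj₂ j∈i) = ⊥-elim (first-new-is-new f j (value-persists v′ i ni j∈i y h))

  record Enumerates (w t : C) : Set ℓ where
    field
      total      : ∀ k → Natural k → ∃[ a ] MapsTo U t k a
      index      : ∀ {k a} → MapsTo U t k a → Natural k
      functional : ∀ {k a a′} → MapsTo U t k a → MapsTo U t k a′ → a ≡ a′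
      injective  : ∀ {k k′ a} → MapsTo U t k a → MapsTo U t k′ a → k ≡ k′
      urelement  : ∀ {k a} → MapsTo U t k a → 𝒜 a
      outside    : ∀ {k a} → MapsTo U t k a → ¬ a ∈ w

  opaque
    enumeration : ∀ w → ∃[ t ] Enumerates w t
    enumeration w = t , record
      { total      = λ k nat → let (y , h) = initial-exists k nat ; (a , f) = first-new-exists nat h in
                       a , ⟪ k , a ⟫ , from (t-spec _) (k , from ω-spec nat , y , a , h , f , ordered-pair k a) , ordered-pair k a
      ; index      = λ m → proj₁ (value m)
      ; functional = λ m m′ → value-unique (proj₁ (value m)) (proj₂ (value m)) (proj₂ (value m′))
      ; injective  = λ m m′ → value-injective (proj₁ (value m)) (proj₁ (value m′)) (proj₂ (value m)) (proj₂ (value m′))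
      ; urelement  = λ m → proj₁ (range m)
      ; outside    = λ m → proj₂ (range m)
      }
      where
      open Greedy w
      open FiniteSequences w using (sequences)
      Entry : C → C → Set ℓ
      Entry k p = ∃[ y ] ∃[ a ] (Initial k y × FirstNew k y a × IsOrderedPair U p k a)
      entry-exists : ∀ k → k ∈ ω → ∃[ p ] Entry k p
      entry-exists k k∈ with initial-exists k (to ω-spec k∈)
      ... | y , h with first-new-exists (to ω-spec k∈) h
      ... | a , f = ⟪ k , a ⟫ , y , a , h , f , ordered-pair k a
      entry-unique : ∀ k p p′ → k ∈ ω → Entry k p → Entry k p′ → p ≡ p′
      entry-unique k p p′ k∈ (y , a , h , f , o) (y′ , a′ , h′ , f′ , o′)
        with value-unique (to ω-spec k∈) (y , h , f) (y′ , h′ , f′)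
      ... | refl = trans (ordered-pair-unique o) (sym (ordered-pair-unique o′))
      t-sig : ∃[ t ] (IsSet U t × (∀ p → (p ∈ t) ⇔ (∃[ k ] (k ∈ ω × Entry k p))))
      t-sig = replace (ex (ex (iterateF 0F 1F 2F 1F ∧ firstNewF 4F 2F 1F 0F ∧ orderedPairF 3F 2F 0F))) E (sequences ∷ []) ω
                entry-exists entry-unique
      t : C
      t = proj₁ t-sig
      t-spec : ∀ p → (p ∈ t) ⇔ (∃[ k ] (k ∈ ω × Entry k p))
      t-spec = proj₂ (proj₂ t-sig)
      value : ∀ {k a} → MapsTo U t k a → Natural k × Value k a
      value m with to (t-spec _) (mapsTo⇒∈ m)
      ... | k , k∈ , y , a , h , f , o with ⟪⟫-injective (ordered-pair-unique o)
      ... | refl , refl = to ω-spec k∈ , y , h , f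
      range : ∀ {k a} → MapsTo U t k a → 𝒜 a × ¬ a ∈ w
      range m = let (nat , _ , _ , f) = value m in first-new-range nat f

-- Failure of Basic Law V when the urelements form a proper class

infinitelyMeetsF : ∀ {b m n} → Fin n → Fin n → Fm b m n
infinitelyMeetsF c s = ex (ex (0F ∊ 1F) ∧ all (0F ∊ 1F ⊃
  ex ((0F ∊ suc (suc (suc c)) ∧ 0F ∊ suc (suc (suc s))) ∧ not (0F ∊ 1F) ∧
    ex (0F ∊ 3F ∧ all (0F ∊ 1F ⊂⊃ (0F ∊ 3F ∨ 0F ≐ 2F))))))

transitiveF : ∀ {b m n} → Fin n → Fm b m n
transitiveF t = all (0F ∊ suc t ⊃ all (0F ∊ 1F ⊃ 0F ∊ suc (suc t)))

module ProperClass {ℓ} (em : ExcludedMiddle ℓ) (U : Structure ℓ) (Z : ZFUR U) (collection : Collection U) (acω : ACω U)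
                   (proper : ¬ UrelementsFormSet U) where
  open Recursion em U Z collection
  open Automorphism em U Z collection
  open Enumeration em U Z collection acω proper using (fresh; enumeration; module Enumerates)
  open ZFUR Z

  -- Infinity without counting: for an infinite set, `H` can be the set of its finite subsets, while
  -- for a finite `Q` a member of `H` with as many points of `Q` as possible could not be enlarged.
  -- This form is monotone in `Q` and makes it easy to remove a point.
  Infinite : (C → Set ℓ) → Set ℓ
  Infinite Q = ∃[ H ] ((∃[ d ] d ∈ H) × (∀ d → d ∈ H →
    ∃[ a ] (Q a × ¬ a ∈ d × ∃[ d′ ] (d′ ∈ H × (∀ z → (z ∈ d′) ⇔ (z ∈ d ⊎ z ≡ a))))))

  opaque
    infinite-mono : ∀ {Q R : C → Set ℓ} → (∀ a → Q a → R a) → Infinite Q → Infinite R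
    infinite-mono i (H , d₀ , h) = H , d₀ , λ d d∈ → let (a , q , rest) = h d d∈ in a , i a q , rest

  -- If some member of H contains b, the members of H containing b form a witness; otherwise H itself is one.
  opaque
    infinite-remove : ∀ {Q : C → Set ℓ} b → Infinite Q → Infinite (λ a → Q a × ¬ a ≡ b)
    infinite-remove {Q} b (H , d₀ , h) with em {∃[ d ] (d ∈ H × b ∈ d)}
    ... | no none = H , d₀ , λ d d∈ → avoid d (h d d∈)
      where
      avoid : ∀ d → ∃[ a ] (Q a × ¬ a ∈ d × ∃[ d′ ] (d′ ∈ H × (∀ z → (z ∈ d′) ⇔ (z ∈ d ⊎ z ≡ a)))) →
              ∃[ a ] ((Q a × ¬ a ≡ b) × ¬ a ∈ d × ∃[ d′ ] (d′ ∈ H × (∀ z → (z ∈ d′) ⇔ (z ∈ d ⊎ z ≡ a))))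
      avoid d (a , q , a∉ , d′ , d′∈ , e) =
        a , (q , λ { refl → none (d′ , d′∈ , from (e a) (inj₂ refl)) }) , a∉ , d′ , d′∈ , e
    ... | yes (d₁ , d₁∈ , b∈d₁) with separate {m = 0} (1F ∊ 0F) [] (b ∷ []) H
    ... | G , _ , k = G , (d₁ , from (k d₁) (d₁∈ , b∈d₁)) , λ d d∈ →
      let (d∈H , b∈d) = to (k d) d∈ ; (a , q , a∉ , d′ , d′∈ , e) = h d d∈H in
      a , (q , λ a≡b → a∉ (subst (_∈ d) (sym a≡b) b∈d)) , a∉ , d′ , from (k d′) (d′∈ , from (e b) (inj₁ b∈d)) , e

  module _ (ϵ : Class U → C) (definable : ParametricallyDefinable U ϵ) (law : BasicLawV U ϵ) where

    P : Class U
    P = proj₁ (proj₂ definable)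

    p : C
    p = proj₂ P

    opaque
      t₀ : C
      t₀ = proj₁ (transitive-hull p)
      p∈t₀ : p ∈ t₀
      p∈t₀ = proj₁ (proj₂ (transitive-hull p))
      t₀-transitive : Transitive t₀
      t₀-transitive = proj₂ (proj₂ (transitive-hull p))

    opaque
      t : C
      t = proj₁ (enumeration t₀)
      t-enumerates : Enumeration.Enumerates em U Z collection acω proper t₀ t
      t-enumerates = proj₂ (enumeration t₀)

    opaque
      t′ : C
      -- ⋃ (⋃ t) contains the values of `t`; avoiding it as well makes the two ranges disjoint.
      t′ = proj₁ (enumeration (t₀ ∪ ⋃ (⋃ t)))
      t′-enumerates : Enumeration.Enumerates em U Z collection acω proper (t₀ ∪ ⋃ (⋃ t)) t′
      t′-enumerates = proj₂ (enumeration (t₀ ∪ ⋃ (⋃ t)))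

    module T = Enumerates t-enumerates
    module T′ = Enumerates t′-enumerates

    opaque
      ranges-disjoint : ∀ {k k′ a} → MapsTo U t k a → ¬ MapsTo U t′ k′ a
      ranges-disjoint m m′ = T′.outside m′ (∈-∪ʳ (mapsTo-⋃⋃ m))

    opaque
      B-sig : ∃[ B ] (∀ a → (a ∈ B) ⇔ (∃[ k ] MapsTo U t k a))
      B-sig with separate {m = 0} (ex (mapsToF 2F 0F 1F)) [] (t ∷ []) (⋃ (⋃ t))
      ... | B , _ , h = B , λ a → mk⇔ (λ a∈ → proj₂ (to (h a) a∈))
                                      λ (k , m) → from (h a) (mapsTo-⋃⋃ m , k , m)

    opaque
      B : C
      B = proj₁ B-sig
      B-spec : ∀ {a} → (a ∈ B) ⇔ (∃[ k ] MapsTo U t k a)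
      B-spec {a} = proj₂ B-sig a

    private
      Segment : C → C → Set ℓ
      Segment k d = IsSet U d × (∀ a → (a ∈ d) ⇔ (∃[ i ] (i ∈ k × MapsTo U t i a)))

      opaque
        segment : ∀ k → ∃[ d ] Segment k d
        segment k with separate {m = 0} (ex (0F ∊ 2F ∧ mapsToF 3F 0F 1F)) [] (k ∷ t ∷ []) (⋃ (⋃ t))
        ... | d , set , h = d , set , λ a → mk⇔ (λ a∈ → proj₂ (to (h a) a∈))
                                                λ (i , i∈ , m) → from (h a) (mapsTo-⋃⋃ m , i , i∈ , m)

      opaque
        segment-unique : ∀ {k d d′} → Segment k d → Segment k d′ → d ≡ d′
        segment-unique (s , h) (s′ , h′) = extensionality _ _ s s′ λ a → h a ⇔∘ ⇔-sym (h′ a)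

    opaque
      -- The witness consists of the initial segments of the enumeration `t`. The condition is
      -- doubled because it is the instance c = B of the formula that defines `X`.
      B-infinite : Infinite (λ a → a ∈ B × a ∈ B)
      B-infinite with replace {m = 0} (setF 1F ∧ all (0F ∊ 2F ⊂⊃ ex (0F ∊ 2F ∧ mapsToF 4F 0F 1F))) [] (t ∷ []) ω
                        (λ k _ → segment k) (λ k d d′ _ → segment-unique)
      ... | H , _ , h = H , (_ , from (h _) (∅ , from ω-spec natural-∅ , proj₂ (segment ∅))) , step
        where
        step : ∀ d → d ∈ H → ∃[ a ] ((a ∈ B × a ∈ B) × ¬ a ∈ d × ∃[ d′ ] (d′ ∈ H × (∀ z → (z ∈ d′) ⇔ (z ∈ d ⊎ z ≡ a))))
        step d d∈ with to (h d) d∈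
        ... | k , k∈ω , _ , d-spec with T.total k (to ω-spec k∈ω) | segment (succ k)
        ... | a , m | d′ , set , d′-spec =
          a , (a∈B , a∈B) , a∉d , d′ , from (h d′) (succ k , from ω-spec (natural-succ (to ω-spec k∈ω)) , set , d′-spec) ,
          λ z → mk⇔ (λ z∈ → forth (to (d′-spec z) z∈)) λ
            { (inj₁ z∈d) → let (i , i∈k , n) = to (d-spec z) z∈d in from (d′-spec z) (i , ∈-∪ˡ i∈k , n)
            ; (inj₂ refl) → from (d′-spec z) (k , ∈-succ , m) }
          where
          a∈B : a ∈ B
          a∈B = from B-spec (k , m)
          a∉d : ¬ a ∈ d
          a∉d a∈ with to (d-spec a) a∈
          ... | i , i∈k , n with T.injective n m
          ... | refl = ∉-refl i∈k
          forth : ∀ {z} → ∃[ i ] (i ∈ succ k × MapsTo U t i z) → z ∈ d ⊎ z ≡ a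
          forth (i , i∈ , n) with to (adjoin-spec i) i∈
          ... | inj₁ i∈k  = inj₁ (from (d-spec _) (i , i∈k , n))
          ... | inj₂ refl = inj₂ (T.functional n m)

    opaque
      X : Class U
      X = class₁ {0} (infinitelyMeetsF 0F 1F) [] (B ∷ [])
      X-spec : ∀ {c} → _∈Class_ U c X ⇔ Infinite (λ a → a ∈ c × a ∈ B)
      X-spec = class₁-spec {0} (infinitelyMeetsF 0F 1F)

    y : C
    y = ϵ X

    module Invariance (g : Class U)
      (g-sym : ∀ {a b} → Related g a b → Related g b a)
      (g-functional : ∀ {a b b′} → Related g a b → Related g a b′ → b ≡ b′)
      (g-total : ∀ {a} → 𝒜 a → ∃[ b ] (𝒜 b × Related g a b))
      (g-fixes : ∀ a → a ∈ t₀ → 𝒜 a → Related g a a)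
      where
      open Extension g g-sym g-functional g-total public

      opaque
        -- The automorphism preserves satisfaction of the formula that defines `ϵ`, and it leaves
        -- the class `P` alone: the parameter of `P` lies in the transitive set `t₀`, whose
        -- urelements are fixed.
        ϵ-equivariant : ∀ Y → ϵ (extendᶜ Y) ≡ extend (ϵ Y)
        ϵ-equivariant Y = to (correct (extendᶜ Y) (extend (ϵ Y)))
          (subst (λ q → Sat₂ U φ (extendᶜ Y ∷ (proj₁ P , q) ∷ []) (extend (ϵ Y) ∷ []))
            (extend-fixes t₀-transitive g-fixes p p∈t₀)
            (to (sat₂-invariant φ (Y ∷ P ∷ []) (ϵ Y ∷ [])) (from (correct Y (ϵ Y)) refl)))
          where
          φ : Formula₂ 2 1
          φ = proj₁ definable
          correct : ∀ X y → Sat₂ U φ (X ∷ P ∷ []) (y ∷ []) ⇔ (ϵ X ≡ y)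
          correct = proj₂ (proj₂ definable)

      opaque
        ∈-extendᶜ : ∀ {c} Y → _∈Class_ U c (extendᶜ Y) ⇔ _∈Class_ U (extend c) Y
        ∈-extendᶜ {c} (ψ , z) = sat-invariant ψ (c ∷ extend z ∷ []) ⇔∘
          ≡⇒⇔ (cong (λ z → Sat U ψ (extend c ∷ z ∷ [])) (extend-involutive z))

    module Transposition {b b′ : C} (ub : 𝒜 b) (ub′ : 𝒜 b′) (b∉ : ¬ b ∈ t₀) (b′∉ : ¬ b′ ∈ t₀) where

      private
        Swap : C → C → Set ℓ
        Swap x y = (x ≡ b × y ≡ b′) ⊎ (x ≡ b′ × y ≡ b) ⊎ (¬ x ≡ b × ¬ x ≡ b′ × x ≡ y)

        opaque
          g : Class U
          g = class₂ {0} ((0F ≐ 2F ∧ 1F ≐ 3F) ∨ (0F ≐ 3F ∧ 1F ≐ 2F) ∨ (not (0F ≐ 2F) ∧ not (0F ≐ 3F) ∧ 0F ≐ 1F))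
                [] (b ∷ b′ ∷ [])
          g-spec : ∀ {x y} → Related g x y ⇔ Swap x y
          g-spec = class₂-spec {0} ((0F ≐ 2F ∧ 1F ≐ 3F) ∨ (0F ≐ 3F ∧ 1F ≐ 2F) ∨ (not (0F ≐ 2F) ∧ not (0F ≐ 3F) ∧ 0F ≐ 1F))

        swap-sym : ∀ {x y} → Swap x y → Swap y x
        swap-sym (inj₁ (e , e′)) = inj₂ (inj₁ (e′ , e))
        swap-sym (inj₂ (inj₁ (e , e′))) = inj₁ (e′ , e)
        swap-sym (inj₂ (inj₂ (n , n′ , refl))) = inj₂ (inj₂ (n , n′ , refl))

        swap-functional : ∀ {x y y′} → Swap x y → Swap x y′ → y ≡ y′
        swap-functional (inj₁ (refl , refl)) (inj₁ (_ , refl)) = refl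
        swap-functional (inj₁ (refl , refl)) (inj₂ (inj₁ (refl , refl))) = refl
        swap-functional (inj₁ (e , _)) (inj₂ (inj₂ (n , _))) = ⊥-elim (n e)
        swap-functional (inj₂ (inj₁ (refl , refl))) (inj₁ (refl , refl)) = refl
        swap-functional (inj₂ (inj₁ (_ , refl))) (inj₂ (inj₁ (_ , refl))) = refl
        swap-functional (inj₂ (inj₁ (e , _))) (inj₂ (inj₂ (_ , n , _))) = ⊥-elim (n e)
        swap-functional (inj₂ (inj₂ (n , _))) (inj₁ (e , _)) = ⊥-elim (n e)
        swap-functional (inj₂ (inj₂ (_ , n , _))) (inj₂ (inj₁ (e , _))) = ⊥-elim (n e)
        swap-functional (inj₂ (inj₂ (_ , _ , refl))) (inj₂ (inj₂ (_ , _ , refl))) = refl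

        swap-total : ∀ {a} → 𝒜 a → ∃[ c ] (𝒜 c × Related g a c)
        swap-total {a} ua with em {a ≡ b} | em {a ≡ b′}
        ... | yes e | _     = b′ , ub′ , from g-spec (inj₁ (e , refl))
        ... | no _  | yes e = b , ub , from g-spec (inj₂ (inj₁ (e , refl)))
        ... | no n  | no n′ = a , ua , from g-spec (inj₂ (inj₂ (n , n′ , refl)))

        swap-fixes : ∀ {a} → a ∈ t₀ → Related g a a
        swap-fixes a∈ = from g-spec (inj₂ (inj₂ ((λ { refl → b∉ a∈ }) , (λ { refl → b′∉ a∈ }) , refl)))

      open Invariance g
        (λ r → from g-spec (swap-sym (to g-spec r)))
        (λ r r′ → swap-functional (to g-spec r) (to g-spec r′))
        (λ ua → swap-total ua)
        (λ a a∈ _ → swap-fixes a∈) public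

      opaque
        swaps : extend b ≡ b′
        swaps = extend-urelement ub (from g-spec (inj₁ (refl , refl)))

      private
        Elsewhere : C → C → Set ℓ
        Elsewhere c a = ((a ∈ c × a ∈ B) × ¬ a ≡ b) × ¬ a ≡ b′

        opaque
          fixed : ∀ {c a} → Elsewhere c a → extend a ≡ a
          fixed (((_ , a∈B) , n) , n′) = extend-urelement (T.urelement (proj₂ (to B-spec a∈B)))
                                           (from g-spec (inj₂ (inj₂ (n , n′ , refl))))

      opaque
        -- The elements of `B` other than b and b′ are fixed, so c and its image contain the same
        -- ones; `infinite-remove` discards the two exceptional points beforehand.
        X-invariant : ∀ c → _∈Class_ U c (extendᶜ X) ⇔ _∈Class_ U c X
        X-invariant c = ∈-extendᶜ X ⇔∘ X-spec ⇔∘ mk⇔ forth back ⇔∘ ⇔-sym X-spec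
          where
          forth : Infinite (λ a → a ∈ extend c × a ∈ B) → Infinite (λ a → a ∈ c × a ∈ B)
          forth i = infinite-mono
            (λ a e → extend-∈⁻ (subst (_∈ extend c) (sym (fixed e)) (proj₁ (proj₁ (proj₁ e)))) , proj₂ (proj₁ (proj₁ e)))
            (infinite-remove b′ (infinite-remove b i))
          back : Infinite (λ a → a ∈ c × a ∈ B) → Infinite (λ a → a ∈ extend c × a ∈ B)
          back i = infinite-mono
            (λ a e → subst (_∈ extend c) (fixed e) (extend-∈ (proj₁ (proj₁ (proj₁ e)))) , proj₂ (proj₁ (proj₁ e)))
            (infinite-remove b′ (infinite-remove b i))

      opaque
        y-fixed : extend y ≡ y
        y-fixed = trans (sym (ϵ-equivariant X)) (from (law (extendᶜ X) X) X-invariant)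

    opaque
      -- The least transitive set that has `y` as a member. Leastness matters: under an automorphism
      -- that fixes `y`, the image of the hull is another such set and hence includes the hull.
      hull-sig : ∃[ h ] (∀ z → (z ∈ h) ⇔ (∀ s → y ∈ s × Transitive s → z ∈ s))
      hull-sig with transitive-hull y
      ... | s , y∈s , trans-s with separate {m = 0} (all (2F ∊ 0F ∧ transitiveF 0F ⊃ 1F ∊ 0F)) [] (y ∷ []) s
      ... | h , _ , k = h , λ z → mk⇔ (λ z∈ → proj₂ (to (k z) z∈)) λ q → from (k z) (q s (y∈s , trans-s) , q)

    opaque
      hull : C
      hull = proj₁ hull-sig
      hull-spec : ∀ {z} → (z ∈ hull) ⇔ (∀ s → y ∈ s × Transitive s → z ∈ s)
      hull-spec {z} = proj₂ hull-sig z

    opaque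
      y∈hull : y ∈ hull
      y∈hull = from hull-spec λ s (y∈s , _) → y∈s

    opaque
      hull-transitive : Transitive hull
      hull-transitive u u∈ w w∈u = from hull-spec λ s h → proj₂ h u (to hull-spec u∈ s h) w w∈u

    -- Otherwise a transposition would move a to a urelement outside the hull, although it fixes y.
    opaque
      hull-urelements : ∀ a → a ∈ hull → 𝒜 a → a ∈ t₀
      hull-urelements a a∈ ua = byContradiction contra
        where
        contra : ¬ ¬ a ∈ t₀
        contra a∉ with fresh (hull ∪ t₀)
        -- By leastness `a` lies in the image of the hull, so its own image `b` lies in the hull,
        -- against the choice of `b`.
        ... | b , ub , b∉ = b∉ (∈-∪ˡ (subst (b ∈_) (extend-involutive hull)
                (subst (_∈ extend (extend hull)) swaps (extend-∈ (to hull-spec a∈ (extend hull) (y∈ , transitive))))))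
          where
          open Transposition ua ub a∉ (λ b∈ → b∉ (∈-∪ʳ b∈))
          y∈ : y ∈ extend hull
          y∈ = subst (_∈ extend hull) y-fixed (extend-∈ y∈hull)
          transitive : Transitive (extend hull)
          transitive u u∈ w w∈u = subst (_∈ extend hull) (extend-involutive w)
            (extend-∈ (hull-transitive (extend u) (subst (extend u ∈_) (extend-involutive hull) (extend-∈ u∈)) _ (extend-∈ w∈u)))

    private
      Exchange : C → C → Set ℓ
      Exchange x y = (∃[ k ] (MapsTo U t k x × MapsTo U t′ k y)) ⊎ (∃[ k ] (MapsTo U t′ k x × MapsTo U t k y))
                   ⊎ ((∀ k → ¬ MapsTo U t k x) × (∀ k → ¬ MapsTo U t′ k x) × x ≡ y)

      exchangeF : Fm false 0 4
      exchangeF = ex (mapsToF 3F 0F 1F ∧ mapsToF 4F 0F 2F) ∨ ex (mapsToF 4F 0F 1F ∧ mapsToF 3F 0F 2F)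
                ∨ (all (not (mapsToF 3F 0F 1F)) ∧ all (not (mapsToF 4F 0F 1F)) ∧ 0F ≐ 1F)

      opaque
        g : Class U
        g = class₂ exchangeF [] (t ∷ t′ ∷ [])
        g-spec : ∀ {x y} → Related g x y ⇔ Exchange x y
        g-spec = class₂-spec exchangeF

      opaque
        exchange-sym : ∀ {x y} → Exchange x y → Exchange y x
        exchange-sym (inj₁ (k , m , m′)) = inj₂ (inj₁ (k , m′ , m))
        exchange-sym (inj₂ (inj₁ (k , m , m′))) = inj₁ (k , m′ , m)
        exchange-sym (inj₂ (inj₂ (n , n′ , refl))) = inj₂ (inj₂ (n , n′ , refl))

      opaque
        exchange-functional : ∀ {x y y′} → Exchange x y → Exchange x y′ → y ≡ y′
        exchange-functional (inj₁ (k , m , m′)) (inj₁ (k₁ , n , n′)) with T.injective m n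
        ... | refl = T′.functional m′ n′
        exchange-functional (inj₁ (k , m , m′)) (inj₂ (inj₁ (k₁ , n , n′))) = ⊥-elim (ranges-disjoint m n)
        exchange-functional (inj₁ (k , m , m′)) (inj₂ (inj₂ (n , _))) = ⊥-elim (n k m)
        exchange-functional (inj₂ (inj₁ (k , m , m′))) (inj₁ (k₁ , n , n′)) = ⊥-elim (ranges-disjoint n m)
        exchange-functional (inj₂ (inj₁ (k , m , m′))) (inj₂ (inj₁ (k₁ , n , n′))) with T′.injective m n
        ... | refl = T.functional m′ n′
        exchange-functional (inj₂ (inj₁ (k , m , m′))) (inj₂ (inj₂ (_ , n , _))) = ⊥-elim (n k m)
        exchange-functional (inj₂ (inj₂ (n , _))) (inj₁ (k , m , _)) = ⊥-elim (n k m)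
        exchange-functional (inj₂ (inj₂ (_ , n , _))) (inj₂ (inj₁ (k , m , _))) = ⊥-elim (n k m)
        exchange-functional (inj₂ (inj₂ (_ , _ , refl))) (inj₂ (inj₂ (_ , _ , refl))) = refl

      opaque
        exchange-total : ∀ {a} → 𝒜 a → ∃[ c ] (𝒜 c × Related g a c)
        exchange-total {a} ua with em {∃[ k ] MapsTo U t k a} | em {∃[ k ] MapsTo U t′ k a}
        ... | yes (k , m) | _ = let (c , m′) = T′.total k (T.index m) in c , T′.urelement m′ , from g-spec (inj₁ (k , m , m′))
        ... | no _ | yes (k , m) = let (c , m′) = T.total k (T′.index m) in c , T.urelement m′ , from g-spec (inj₂ (inj₁ (k , m , m′)))
        ... | no n | no n′ = a , ua , from g-spec (inj₂ (inj₂ ((λ k m → n (k , m)) , (λ k m → n′ (k , m)) , refl)))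

      opaque
        exchange-fixes : ∀ {a} → a ∈ t₀ → Exchange a a
        exchange-fixes a∈ = inj₂ (inj₂ ((λ k m → T.outside m a∈) , (λ k m → T′.outside m (∈-∪ˡ a∈)) , refl))

    open Invariance g
      (λ r → from g-spec (exchange-sym (to g-spec r)))
      (λ r r′ → exchange-functional (to g-spec r) (to g-spec r′))
      (λ ua → exchange-total ua)
      (λ a a∈ _ → from g-spec (exchange-fixes a∈))

    opaque
      -- Membership would put the image of `B` into `X`. That image is the range of `t′`, which is
      -- disjoint from `B`, whereas infinity provides at least one common element.
      B∉extended : ¬ _∈Class_ U B (extendᶜ X)
      B∉extended h with to X-spec (to (∈-extendᶜ X) h)
      ... | H , (d , d∈) , step with step d d∈
      ... | a , (a∈ , a∈B) , _ with to B-spec a∈B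
      ... | k , m with T′.total k (T.index m)
      ... | c , m′ with to B-spec (subst (_∈ B)
                         (extend-urelement (T.urelement m) (from g-spec (inj₁ (k , m , m′))))
                         (subst (extend a ∈_) (extend-involutive B) (extend-∈ a∈)))
      ... | k′ , n = ranges-disjoint n m′

    opaque
      no-abstraction : ⊥₀
      no-abstraction = B∉extended (to (to (law X (extendᶜ X)) same B) (from X-spec B-infinite))
        where
        same : y ≡ ϵ (extendᶜ X)
        same = sym (trans (ϵ-equivariant X)
          (extend-fixes hull-transitive (λ a a∈ ua → from g-spec (exchange-fixes (hull-urelements a a∈ ua))) y y∈hull))

-- Ranks and Scott's trick

rankF : ∀ {b m n} → Fin n → Fin n → Fm b m n
simulationF : ∀ {b m n} → Fin n → Fm b m n
simulationF f = all (all (mapsToF (suc (suc f)) 1F 0F ⊃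
  all (0F ∊ 2F ⊃ ex (0F ∊ 2F ∧ mapsToF (suc (suc (suc (suc f)))) 1F 0F))))
rankF x y = ex (mapsToF 0F (suc x) (suc y) ∧ simulationF 0F)

-- Comparison of ranks, without ordinals: x ≼ y iff every member of x is ≼ some member of y.
module Rank {ℓ} (em : ExcludedMiddle ℓ) (U : Structure ℓ) (Z : ZFUR U) (collection : Collection U) where
  open Recursion em U Z collection
  open ZFUR Z

  private
    Φ : (C → C → Set ℓ) → C → C → Set ℓ
    Φ S x y = ∀ x′ → x′ ∈ x → ∃[ y′ ] (y′ ∈ y × S x′ y′)

    Φ-mono : ∀ {S S′ : C → C → Set ℓ} → (∀ {x y} → S x y → S′ x y) → ∀ {x y} → Φ S x y → Φ S′ x y
    Φ-mono i h x′ x′∈ = let (y′ , y′∈ , s) = h x′ x′∈ in y′ , y′∈ , i s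

  open Corecursion Φ Φ-mono renaming (Fix to _≼_) public

  opaque
    ≼-intro : ∀ {x y} → (∀ x′ → x′ ∈ x → ∃[ y′ ] (y′ ∈ y × x′ ≼ y′)) → x ≼ y
    ≼-intro {x} {y} h
      with collect {m = 0} (simulationF 1F ∧ ex (0F ∊ 3F ∧ mapsToF 2F 1F 0F)) [] (y ∷ []) x
             (λ x′ x′∈ → let (y′ , y′∈ , f , m , closed) = h x′ x′∈ in f , closed , y′ , y′∈ , m)
    ... | v , k with separate {m = 0} (simulationF 0F) [] [] v
    ... | F , _ , k′ = fold F (λ f f∈ → proj₂ (to (k′ f) f∈)) λ x′ x′∈ →
      let (f , f∈ , closed , y′ , y′∈ , m) = k x′ x′∈ in y′ , y′∈ , f , from (k′ f) (f∈ , closed) , m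

  opaque
    ≼-refl : ∀ x → x ≼ x
    ≼-refl = ∈-induction {m = 0} (rankF 0F 0F) [] [] λ x ih → ≼-intro λ x′ x′∈ → x′ , x′∈ , ih x′ x′∈

  opaque
    ≼-trans : ∀ x y z → x ≼ y → y ≼ z → x ≼ z
    ≼-trans = ∈-induction {m = 0} (all (all (rankF 2F 1F ⊃ rankF 1F 0F ⊃ rankF 2F 0F))) [] []
      λ x ih y z h k → ≼-intro λ x′ x′∈ →
        let (y′ , y′∈ , h′) = unfold h x′ x′∈ ; (z′ , z′∈ , k′) = unfold k y′ y′∈ in z′ , z′∈ , ih x′ x′∈ y′ z′ h′ k′

  opaque
    -- The second alternative is strict, as it places `y` below a member of `x`; `minimal-rank`
    -- descends along it.
    ≼-total : ∀ x y → x ≼ y ⊎ (∃[ x′ ] (x′ ∈ x × y ≼ x′))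
    ≼-total = ∈-induction {m = 0} (all (rankF 1F 0F ∨ ex (0F ∊ 2F ∧ rankF 1F 0F))) [] [] step
      where
      step : ∀ x → (∀ x′ → x′ ∈ x → ∀ y → x′ ≼ y ⊎ (∃[ x″ ] (x″ ∈ x′ × y ≼ x″))) →
             ∀ y → x ≼ y ⊎ (∃[ x′ ] (x′ ∈ x × y ≼ x′))
      step x ih y with em {∃[ x′ ] (x′ ∈ x × ¬ (∃[ y′ ] (y′ ∈ y × x′ ≼ y′)))}
      ... | no none = inj₁ (≼-intro λ x′ x′∈ → byContradiction λ n → none (x′ , x′∈ , n))
      ... | yes (x′ , x′∈ , n) = inj₂ (x′ , x′∈ , ≼-intro λ y′ y′∈ → below y′ y′∈ (ih x′ x′∈ y′))
        where
        below : ∀ y′ → y′ ∈ y → x′ ≼ y′ ⊎ (∃[ x″ ] (x″ ∈ x′ × y′ ≼ x″)) → ∃[ x″ ] (x″ ∈ x′ × y′ ≼ x″)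
        below y′ y′∈ (inj₁ h) = ⊥-elim (n (y′ , y′∈ , h))
        below y′ y′∈ (inj₂ h) = h

  opaque
    -- Without ordinals, the descent is an ∈-induction on a bound `x`: an element of `D` strictly
    -- below `d` is bounded by a member of `d`, hence by a member of `x`.
    minimal-rank : ∀ D → ∃[ d ] _∈Class_ U d D → ∃[ d ] (_∈Class_ U d D × (∀ d′ → _∈Class_ U d′ D → d ≼ d′))
    minimal-rank D (d , d∈) = ∈-induction (all (0F ∊ᶜ 0F ⊃ rankF 0F 1F ⊃ ex (0F ∊ᶜ 0F ∧ all (0F ∊ᶜ 0F ⊃ rankF 1F 0F))))
                                (D ∷ []) [] step d d d∈ (≼-refl d)
      where
      Minimal : Set ℓ
      Minimal = ∃[ d ] (_∈Class_ U d D × (∀ d′ → _∈Class_ U d′ D → d ≼ d′))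
      step : ∀ x → (∀ x′ → x′ ∈ x → ∀ d → _∈Class_ U d D → d ≼ x′ → Minimal) → ∀ d → _∈Class_ U d D → d ≼ x → Minimal
      step x ih d d∈ d≼x with em {∃[ d′ ] (_∈Class_ U d′ D × ¬ d ≼ d′)}
      ... | no none = d , d∈ , λ d′ d′∈ → byContradiction λ n → none (d′ , d′∈ , n)
      ... | yes (d′ , d′∈ , n) with ≼-total d d′
      ... | inj₁ h = ⊥-elim (n h)
      ... | inj₂ (e , e∈ , h) with unfold d≼x e e∈
      ... | x′ , x′∈ , k = ih x′ x′∈ d′ d′∈ (≼-trans d′ e x′ h k)

  module _ (𝒜-set : UrelementsFormSet U) where

    opaque
      -- The members of a set below `y` are below members of `y`, so a powerset bounds such sets.
      -- Urelements, being memberless, are below everything; they are bounded because they form a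
      -- set.
      rank-bounded : ∀ y → ∃[ w ] (∀ x → x ≼ y → x ∈ w)
      rank-bounded = ∈-induction {m = 0} (ex (all (rankF 0F 2F ⊃ 0F ∊ 1F))) [] [] step
        where
        step : ∀ y → (∀ y′ → y′ ∈ y → ∃[ w ] (∀ x → x ≼ y′ → x ∈ w)) → ∃[ w ] (∀ x → x ≼ y → x ∈ w)
        step y ih with collect {m = 0} (all (rankF 0F 1F ⊃ 0F ∊ 2F)) [] [] y ih
        ... | v , h with powerset (⋃ v)
        ... | P , _ , P-spec = P ∪ proj₁ 𝒜-set , bounded
          where
          bounded : ∀ x → x ≼ y → x ∈ P ∪ proj₁ 𝒜-set
          bounded x x≼y with em {𝒜 x}
          ... | yes ux = ∈-∪ʳ (from (proj₂ (proj₂ 𝒜-set) x) ux)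
          ... | no sx  = ∈-∪ˡ (from (P-spec x) (sx , λ z z∈ →
            let (y′ , y′∈ , z≼) = unfold x≼y z z∈ ; (w , w∈v , k) = h y′ y′∈ in from (⋃-spec z) (w , w∈v , k z z≼)))

    opaque
      scott : ∀ D → ∃[ d ] _∈Class_ U d D →
              ∃[ v ] (IsSet U v × (∃[ d ] d ∈ v) ×
                (∀ d → (d ∈ v) ⇔ (_∈Class_ U d D × (∀ d′ → _∈Class_ U d′ D → d ≼ d′))))
      scott D inhabited with minimal-rank D inhabited
      ... | d , d∈ , min with rank-bounded d
      ... | w , bound with separate (0F ∊ᶜ 0F ∧ all (0F ∊ᶜ 0F ⊃ rankF 1F 0F)) (D ∷ []) [] w
      ... | v , set , h = v , set , (d , from (h d) (bound d (≼-refl d) , d∈ , min)) ,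
            λ e → mk⇔ (λ e∈ → proj₂ (to (h e) e∈)) λ (e∈ , min′) → from (h e) (bound e (min′ d d∈) , e∈ , min′)

-- Codes of formulas and partial truth classes

numeralF : ∀ {b m n} → ℕ → Fin n → Fm b m n
numeralF zero    x = emptyF x
numeralF (suc i) x = ex (successorF (suc x) 0F ∧ numeralF i 0F)

-- Below the first four quantifiers the variables 3, 2, 1, 0 are t, r, u, v with c = ⟪ t , r ⟫ and r = ⟪ u , v ⟫;
-- the tags t = 0, …, 4 stand for membership, equality, being a urelement, implication and quantification.
clauseF : ∀ {b m n} → Fin m → Fin n → Fin n → Fin n → Fm b m n
clauseF S k c e = ex (ex (ex (ex (orderedPairF (4 ↑ʳ c) 3F 2F ∧ orderedPairF 2F 1F 0F ∧
  (numeralF 0 3F ∧ ex (ex (mapsToF (6 ↑ʳ e) 3F 1F ∧ mapsToF (6 ↑ʳ e) 2F 0F ∧ 1F ∊ 0F)) ∨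
   numeralF 1 3F ∧ ex (mapsToF (5 ↑ʳ e) 2F 0F ∧ mapsToF (5 ↑ʳ e) 1F 0F) ∨
   numeralF 2 3F ∧ ex (mapsToF (5 ↑ʳ e) 2F 0F ∧ ur 0F) ∨
   numeralF 3 3F ∧ ex (successorF (5 ↑ʳ k) 0F ∧ (related₃F S 0F 2F (5 ↑ʳ e) ⊃ related₃F S 0F 1F (5 ↑ʳ e))) ∨
   numeralF 4 3F ∧ ex (successorF (5 ↑ʳ k) 0F ∧ all (all (extendsF 0F (7 ↑ʳ e) 4F 1F ⊃ related₃F S 2F 3F 0F))))))))

-- Tarski's clauses for all levels up to `n`. A compound code at one level refers to the preceding
-- level only, so the recursion runs on the level and not on the structure of codes.
correctF : ∀ {b m n} → Fin m → Fin n → Fm b m n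
correctF S n = all ((0F ∊ suc n ∨ 0F ≐ suc n) ⊃ all (all (related₃F S 2F 1F 0F ⊂⊃ clauseF S 2F 1F 0F)))

-- d = ⟪ u , ⟪ c , e ⟫ ⟫ describes the class of those x for which c holds, at level n, under e extended by u ↦ x.
describesF : ∀ {b m n} → Fin m → Fin n → Fin n → Fin n → Fm b m n
describesF S n d x = ex (ex (ex (ex (ex (orderedPairF (5 ↑ʳ d) 4F 3F ∧ orderedPairF 3F 2F 1F
  ∧ extendsF 0F 1F 4F (5 ↑ʳ x) ∧ related₃F S (5 ↑ʳ n) 2F 0F)))))

depth : ∀ {n} → Formula n → ℕ
depth (φ ⇒ ψ) = suc (depth φ ⊔ depth ψ)
depth (∀′ φ)  = suc (depth φ)
depth _       = 0

-- Variables are named by de Bruijn levels, so that a name is not affected by later quantifiers.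
level : ∀ {n} → Fin n → ℕ
level {suc n} zero    = n
level {suc n} (suc i) = level i

level< : ∀ {n} (i : Fin n) → level i < n
level< {suc n} zero    = ≤-refl
level< {suc n} (suc i) = m≤n⇒m≤1+n (level< i)

module Truth {ℓ} (em : ExcludedMiddle ℓ) (U : Structure ℓ) (Z : ZFUR U) (collection : Collection U) where
  open Recursion em U Z collection

  num : ℕ → C
  num zero    = ∅
  num (suc i) = succ (num i)

  opaque
    num-natural : ∀ i → Natural (num i)
    num-natural zero    = natural-∅
    num-natural (suc i) = natural-succ (num-natural i)

  opaque
    num-injective : ∀ i j → num i ≡ num j → i ≡ j
    num-injective zero    zero    _ = refl
    num-injective zero    (suc j) e = ⊥-elim (succ≢∅ (sym e))
    num-injective (suc i) zero    e = ⊥-elim (succ≢∅ e)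
    num-injective (suc i) (suc j) e = cong suc (num-injective i j (succ-injective e))

  opaque
    num-∈⁻ : ∀ i {x} → x ∈ num i → ∃[ j ] (j < i × x ≡ num j)
    num-∈⁻ zero    x∈ = ⊥-elim (∉-∅ x∈)
    num-∈⁻ (suc i) x∈ with to (adjoin-spec _) x∈
    ... | inj₂ e   = i , ≤-refl , e
    ... | inj₁ x∈i = let (j , j<i , e) = num-∈⁻ i x∈i in j , m≤n⇒m≤1+n j<i , e

  opaque
    num-≤ : ∀ {i j} → i ≤′ j → num i ∈ num j ⊎ num i ≡ num j
    num-≤ ≤′-refl = inj₂ refl
    num-≤ (≤′-step h) with num-≤ h
    ... | inj₁ i∈ = inj₁ (∈-∪ˡ i∈)
    ... | inj₂ e  = inj₁ (from (adjoin-spec _) (inj₂ e))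

  opaque
    numeral-spec : ∀ {b m n} i (x : Fin n) {E e} → ⟦ U ⟧ (numeralF {b} {m} i x) E e ⇔ (lookup e x ≡ num i)
    numeral-spec zero x = mk⇔ ∅-unique λ h → subst (IsEmptySet U) (sym h) ∅-empty
    numeral-spec {b} {m} (suc i) x {E} {e} = mk⇔
      (λ (y , s , h) → trans (succ-unique s) (cong succ (to (numeral-spec {b} {m} i 0F {E} {y ∷ e}) h)))
      λ h → num i , subst (λ z → IsSuccessor U z (num i)) (sym h) (succ-spec _) ,
            from (numeral-spec {b} {m} i 0F {E} {num i ∷ e}) refl

  Branch : ℕ → Class U → C → C → C → C → Set ℓ
  Branch 0 S k u v e = ∃[ a ] ∃[ b ] (MapsTo U e u a × MapsTo U e v b × a ∈ b)
  Branch 1 S k u v e = ∃[ a ] (MapsTo U e u a × MapsTo U e v a)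
  Branch 2 S k u v e = ∃[ a ] (MapsTo U e u a × 𝒜 a)
  Branch 3 S k u v e = ∃[ j ] (IsSuccessor U k j × (Related₃ S j u e → Related₃ S j v e))
  Branch 4 S k u v e = ∃[ j ] (IsSuccessor U k j × (∀ x e′ → Extends e′ e u x → Related₃ S j v e′))
  Branch _ S k u v e = ⊥

  Clause : Class U → C → C → C → Set ℓ
  Clause S k c e = ∃[ i ] ∃[ u ] ∃[ v ] (c ≡ ⟪ num i , ⟪ u , v ⟫ ⟫ × Branch i S k u v e)

  opaque
    clauseF-spec : ∀ {b m n} (S : Fin m) (k c e : Fin n) {E v} →
                   ⟦ U ⟧ (clauseF {b} S k c e) E v ⇔ Clause (lookup E S) (lookup v k) (lookup v c) (lookup v e)
    clauseF-spec {b} {m} {n} Sᵢ kᵢ cᵢ eᵢ {E} {w} = mk⇔ forth back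
      where
      S : Class U
      S = lookup E Sᵢ
      k c e : C
      k = lookup w kᵢ
      c = lookup w cᵢ
      e = lookup w eᵢ
      tagged : ∀ i {t r u v} → IsOrderedPair U c t r → IsOrderedPair U r u v → t ≡ num i → Branch i S k u v e → Clause S k c e
      tagged i o o′ refl h =
        i , _ , _ , trans (ordered-pair-unique o) (cong ⟪ num i ,_⟫ (ordered-pair-unique o′)) , h
      tag : ∀ i {t r u v} → ⟦ U ⟧ (numeralF {b} {m} i 3F) E (v ∷ u ∷ r ∷ t ∷ w) ⇔ (t ≡ num i)
      tag i = numeral-spec {b} {m} i 3F
      forth : ⟦ U ⟧ (clauseF {b} Sᵢ kᵢ cᵢ eᵢ) E w → Clause S k c e
      forth (t , r , u , v , o , o′ , inj₁ (n , h)) = tagged 0 o o′ (to (tag 0 {t} {r} {u} {v}) n) h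
      forth (t , r , u , v , o , o′ , inj₂ (inj₁ (n , h))) = tagged 1 o o′ (to (tag 1 {t} {r} {u} {v}) n) h
      forth (t , r , u , v , o , o′ , inj₂ (inj₂ (inj₁ (n , h)))) = tagged 2 o o′ (to (tag 2 {t} {r} {u} {v}) n) h
      forth (t , r , u , v , o , o′ , inj₂ (inj₂ (inj₂ (inj₁ (n , h))))) = tagged 3 o o′ (to (tag 3 {t} {r} {u} {v}) n) h
      forth (t , r , u , v , o , o′ , inj₂ (inj₂ (inj₂ (inj₂ (n , h))))) = tagged 4 o o′ (to (tag 4 {t} {r} {u} {v}) n) h
      split : ∀ {t r} → c ≡ ⟪ t , r ⟫ → IsOrderedPair U c t r
      split eq = subst (λ c → IsOrderedPair U c _ _) (sym eq) (ordered-pair _ _)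
      back : Clause S k c e → ⟦ U ⟧ (clauseF {b} Sᵢ kᵢ cᵢ eᵢ) E w
      back (0 , u , v , eq , h) = _ , _ , u , v , split eq , ordered-pair _ _ ,
        inj₁ (from (tag 0 {_} {⟪ u , v ⟫} {u} {v}) refl , h)
      back (1 , u , v , eq , h) = _ , _ , u , v , split eq , ordered-pair _ _ ,
        inj₂ (inj₁ (from (tag 1 {_} {⟪ u , v ⟫} {u} {v}) refl , h))
      back (2 , u , v , eq , h) = _ , _ , u , v , split eq , ordered-pair _ _ ,
        inj₂ (inj₂ (inj₁ (from (tag 2 {_} {⟪ u , v ⟫} {u} {v}) refl , h)))
      back (3 , u , v , eq , h) = _ , _ , u , v , split eq , ordered-pair _ _ ,
        inj₂ (inj₂ (inj₂ (inj₁ (from (tag 3 {_} {⟪ u , v ⟫} {u} {v}) refl , h))))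
      back (4 , u , v , eq , h) = _ , _ , u , v , split eq , ordered-pair _ _ ,
        inj₂ (inj₂ (inj₂ (inj₂ (from (tag 4 {_} {⟪ u , v ⟫} {u} {v}) refl , h))))
      back (suc (suc (suc (suc (suc _)))) , _ , _ , _ , ())

  opaque
    clause⇔branch : ∀ i S k u v e → Clause S k ⟪ num i , ⟪ u , v ⟫ ⟫ e ⇔ Branch i S k u v e
    clause⇔branch i S k u v e = mk⇔ forth λ h → i , u , v , refl , h
      where
      forth : Clause S k ⟪ num i , ⟪ u , v ⟫ ⟫ e → Branch i S k u v e
      forth (j , u′ , v′ , eq , h) with ⟪⟫-injective eq
      ... | p , q with num-injective i j p | ⟪⟫-injective q
      ... | refl | refl , refl = h

  Agree : Class U → Class U → C → Set ℓ
  Agree S S′ k = ∀ c e → Related₃ S k c e ⇔ Related₃ S′ k c e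

  opaque
    clause-mono : ∀ S S′ {k} → (∀ j → IsSuccessor U k j → Agree S S′ j) → ∀ {c e} → Clause S k c e → Clause S′ k c e
    clause-mono S S′ agree (0 , h) = 0 , h
    clause-mono S S′ agree (1 , h) = 1 , h
    clause-mono S S′ agree (2 , h) = 2 , h
    clause-mono S S′ agree (3 , u , v , eq , j , s , h) =
      3 , u , v , eq , j , s , λ p → to (agree j s _ _) (h (from (agree j s _ _) p))
    clause-mono S S′ agree (4 , u , v , eq , j , s , h) =
      4 , u , v , eq , j , s , λ x e′ ext → to (agree j s _ _) (h x e′ ext)
    clause-mono S S′ agree (suc (suc (suc (suc (suc _)))) , _ , _ , _ , ())

  opaque
    clause-cong : ∀ {S S′ k} → (∀ j → IsSuccessor U k j → Agree S S′ j) → ∀ {c e} → Clause S k c e ⇔ Clause S′ k c e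
    clause-cong {S} {S′} agree = mk⇔ (clause-mono S S′ agree) (clause-mono S′ S λ j s c e → ⇔-sym (agree j s c e))

  Correct : Class U → C → Set ℓ
  Correct S n = ∀ k → k ∈ n ⊎ k ≡ n → ∀ c e → Related₃ S k c e ⇔ Clause S k c e

  opaque
    correctF-spec : ∀ {b m n} (S : Fin m) (k : Fin n) {E v} →
                    ⟦ U ⟧ (correctF {b} S k) E v ⇔ Correct (lookup E S) (lookup v k)
    correctF-spec {b} S n {E} {v} = mk⇔ (λ h k k≤ c e → h k k≤ c e ⇔∘ clauseF-spec {b} S 2F 1F 0F {E} {e ∷ c ∷ k ∷ v})
                                (λ h k k≤ c e → h k k≤ c e ⇔∘ ⇔-sym (clauseF-spec {b} S 2F 1F 0F {E} {e ∷ c ∷ k ∷ v}))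

  opaque
    predecessor-≤ : ∀ {m k j} → Natural m → k ∈ succ m ⊎ k ≡ succ m → IsSuccessor U k j → j ∈ m ⊎ j ≡ m
    predecessor-≤ {m} {k} {j} nat h s with succ-unique s
    ... | refl with h
    ... | inj₂ e = inj₂ (succ-injective e)
    ... | inj₁ k∈ with to (adjoin-spec _) k∈
    ... | inj₁ k∈m  = inj₁ (natural-transitive m nat _ k∈m j ∈-succ)
    ... | inj₂ refl = inj₁ ∈-succ

  opaque
    -- Induction inside `U` on the level, hence valid for nonstandard `n` as well. It makes the
    -- choice of the truth class in `DescribedBy` immaterial.
    correct-unique : ∀ {S S′ n} → Natural n → Correct S n → Correct S′ n → Agree S S′ n
    correct-unique {S} {S′} {n} nat h h′ = all-below n nat (inj₂ refl)
      where
      agree : ∀ k → (∀ j → IsSuccessor U k j → Agree S S′ j) → k ∈ n ⊎ k ≡ n → Agree S S′ k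
      agree k ih k≤ c e = h k k≤ c e ⇔∘ clause-cong {S} {S′} {k} ih {c} {e} ⇔∘ ⇔-sym (h′ k k≤ c e)
      all-below : ∀ k → Natural k → k ∈ n ⊎ k ≡ n → Agree S S′ k
      all-below = induction
        ((0F ∊ 1F ∨ 0F ≐ 1F) ⊃ all (all (related₃F 0F 2F 1F 0F ⊂⊃ related₃F 1F 2F 1F 0F))) (S ∷ S′ ∷ []) (n ∷ [])
        (agree ∅ λ j s → ⊥-elim (succ≢∅ (sym (succ-unique s)))) step
        where
        step : ∀ k → Natural k → (k ∈ n ⊎ k ≡ n → Agree S S′ k) → succ k ∈ n ⊎ succ k ≡ n → Agree S S′ (succ k)
        step k _ ih le = agree (succ k) (λ j s → subst (Agree S S′) (succ-injective (succ-unique s)) (ih (lower le))) le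
          where
          lower : succ k ∈ n ⊎ succ k ≡ n → k ∈ n ⊎ k ≡ n
          lower (inj₁ k∈)   = inj₁ (natural-transitive n nat _ k∈ k ∈-succ)
          lower (inj₂ refl) = inj₁ ∈-succ

  opaque
    clauseClass : Class U → Class U
    clauseClass S = class₃ (clauseF 0F 0F 1F 2F) (S ∷ []) []
    clauseClass-spec : ∀ S k c e → Related₃ (clauseClass S) k c e ⇔ Clause S k c e
    clauseClass-spec S k c e =
      class₃-spec (clauseF {false} 0F 0F 1F 2F) {S ∷ []} {[]} {k} {c} {e}
      ⇔∘ clauseF-spec {false} 0F 0F 1F 2F {S ∷ []} {k ∷ c ∷ e ∷ []}

  -- The i-th stage is correct below i; correctness at every level would contradict Tarski's theorem.
  stage : ℕ → Class U
  stage zero    = clauseClass (⊥′ , ∅)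
  stage (suc i) = clauseClass (stage i)

  opaque
    -- Level 0 refers to no earlier level, so one application of the clauses settles it whatever
    -- class came before; each further application settles one more level.
    stage-stable : ∀ i k → k ∈ num i ⊎ k ≡ num i → Agree (stage (suc i)) (stage i) k
    stage-stable zero k k≤ c e = clauseClass-spec (stage 0) k c e ⇔∘ clause-cong {stage 0} {⊥′ , ∅} {k} (λ j s → ⊥-elim (no-predecessor k≤ s)) {c} {e} ⇔∘
                                 ⇔-sym (clauseClass-spec (⊥′ , ∅) k c e)
      where
      no-predecessor : ∀ {k j} → k ∈ ∅ ⊎ k ≡ ∅ → ¬ IsSuccessor U k j
      no-predecessor (inj₁ k∈) _ = ∉-∅ k∈
      no-predecessor (inj₂ e) s  = succ≢∅ (trans (sym (succ-unique s)) e)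
    stage-stable (suc i) k k≤ c e = clauseClass-spec (stage (suc i)) k c e ⇔∘
      clause-cong {stage (suc i)} {stage i} {k} (λ j s → stage-stable i j (predecessor-≤ (num-natural i) k≤ s)) {c} {e} ⇔∘ ⇔-sym (clauseClass-spec (stage i) k c e)

  opaque
    stage-correct : ∀ i → Correct (stage (suc i)) (num i)
    stage-correct i k k≤ c e = clauseClass-spec (stage i) k c e ⇔∘
      clause-cong {stage i} {stage (suc i)} {k} (λ j s c e → ⇔-sym (stage-stable i j (lower k≤ s) c e)) {c} {e}
      where
      lower : ∀ {j} → k ∈ num i ⊎ k ≡ num i → IsSuccessor U k j → j ∈ num i ⊎ j ≡ num i
      lower (inj₁ k∈) s = predecessor-≤ (num-natural i) (inj₁ (∈-∪ˡ k∈)) s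
      lower (inj₂ refl) s = predecessor-≤ (num-natural i) (inj₁ ∈-succ) s

  -- Falsum gets the tag 5. `Branch` has no clause for it, so its code is false at every level.
  code : ∀ {n} → Formula n → C
  code (i ∈′ j)     = ⟪ num 0 , ⟪ num (level i) , num (level j) ⟫ ⟫
  code (i ≈′ j)     = ⟪ num 1 , ⟪ num (level i) , num (level j) ⟫ ⟫
  code (𝒜′ i)       = ⟪ num 2 , ⟪ num (level i) , ∅ ⟫ ⟫
  code (φ ⇒ ψ)      = ⟪ num 3 , ⟪ code φ , code ψ ⟫ ⟫
  code {n} (∀′ φ)   = ⟪ num 4 , ⟪ num n , code φ ⟫ ⟫
  code ⊥′           = ⟪ num 5 , ⟪ ∅ , ∅ ⟫ ⟫

  -- The second condition keeps the name `num n` free, so that extending `e` there yields exactly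
  -- one value.
  Represents : ∀ {n} → Vec C n → C → Set ℓ
  Represents {n} v e = (∀ i a → MapsTo U e (num (level i)) a ⇔ (a ≡ lookup v i))
                     × (∀ k a → n ≤ k → ¬ MapsTo U e (num k) a)

  opaque
    represents-∅ : Represents [] ∅
    represents-∅ = (λ ()) , λ k a _ m → ∉-∅ (mapsTo⇒∈ m)

  opaque
    represents-extend : ∀ {n} {v : Vec C n} {e e′ x} → Represents v e → Extends e′ e (num n) x → Represents (x ∷ v) e′
    represents-extend {n} {v} {e} {e′} {x} (h , none) ext = values , none′
      where
      values : ∀ i a → MapsTo U e′ (num (level i)) a ⇔ (a ≡ lookup (x ∷ v) i)
      values zero a = mk⇔ (λ m → forth (extends⁻ ext m)) λ { refl → extends-new ext }
        where
        forth : MapsTo U e (num n) a ⊎ (num n ≡ num n × a ≡ x) → a ≡ x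
        forth (inj₁ m)       = ⊥-elim (none n a ≤-refl m)
        forth (inj₂ (_ , p)) = p
      values (suc i) a = mk⇔ (λ m → forth (extends⁻ ext m)) λ p → extends-old ext (from (h i a) p)
        where
        forth : MapsTo U e (num (level i)) a ⊎ (num (level i) ≡ num n × a ≡ x) → a ≡ lookup v i
        forth (inj₁ m)       = to (h i a) m
        forth (inj₂ (p , _)) = ⊥-elim (<⇒≢ (level< i) (num-injective _ _ p))
      none′ : ∀ k a → suc n ≤ k → ¬ MapsTo U e′ (num k) a
      none′ k a n<k m with extends⁻ ext m
      ... | inj₁ m′      = none k a (<⇒≤ n<k) m′
      ... | inj₂ (p , _) = <⇒≢ n<k (sym (num-injective _ _ p))

  module _ {N : ℕ} {S : Class U} (correct : Correct S (num N)) where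

    private
      evaluate : ∀ {i} → i ≤ N → ∀ t u v e → Related₃ S (num i) ⟪ num t , ⟪ u , v ⟫ ⟫ e ⇔ Branch t S (num i) u v e
      evaluate {i} i≤N t u v e = correct (num i) (num-≤ (≤⇒≤′ i≤N)) _ e ⇔∘ clause⇔branch t S (num i) u v e

    opaque
      -- External induction on `φ`, where implication and quantification use up one level each. The
      -- inductive hypotheses are stated for every `j` equal to `num i` because a branch only
      -- provides some predecessor `j`.
      truth : ∀ {n} (φ : Formula n) i → depth φ ≤ i → i ≤ N → ∀ v e → Represents v e →
              Related₃ S (num i) (code φ) e ⇔ Sat U φ v
      truth (p ∈′ q) i _ i≤N v e (rep , _) = evaluate i≤N 0 _ _ e ⇔∘ mk⇔ forth
        λ h → _ , _ , from (rep p _) refl , from (rep q _) refl , h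
        where
        forth : Branch 0 S (num i) (num (level p)) (num (level q)) e → lookup v p ∈ lookup v q
        forth (a , b , m , m′ , h) with to (rep p a) m | to (rep q b) m′
        ... | refl | refl = h
      truth (p ≈′ q) i _ i≤N v e (rep , _) = evaluate i≤N 1 _ _ e ⇔∘ mk⇔
        (λ (a , m , m′) → trans (sym (to (rep p a) m)) (to (rep q a) m′))
        λ h → _ , from (rep p _) refl , from (rep q _) h
      truth (𝒜′ p) i _ i≤N v e (rep , _) = evaluate i≤N 2 _ _ e ⇔∘ mk⇔
        (λ (a , m , h) → subst 𝒜 (to (rep p a) m) h)
        λ h → _ , from (rep p _) refl , h
      truth ⊥′ i _ i≤N v e _ = evaluate i≤N 5 _ _ e
      truth (φ ⇒ ψ) (suc i) (s≤s d) i≤N v e rep = evaluate i≤N 3 _ _ e ⇔∘ mk⇔ forth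
        λ h → num i , succ-spec _ , λ p → from (ihψ (num i) refl) (h (to (ihφ (num i) refl) p))
        where
        ihφ : ∀ j → j ≡ num i → Related₃ S j (code φ) e ⇔ Sat U φ v
        ihφ _ refl = truth φ i (m⊔n≤o⇒m≤o (depth φ) (depth ψ) d) (<⇒≤ i≤N) v e rep
        ihψ : ∀ j → j ≡ num i → Related₃ S j (code ψ) e ⇔ Sat U ψ v
        ihψ _ refl = truth ψ i (m⊔n≤o⇒n≤o (depth φ) (depth ψ) d) (<⇒≤ i≤N) v e rep
        forth : Branch 3 S (succ (num i)) (code φ) (code ψ) e → Sat U φ v → Sat U ψ v
        forth (j , s , h) p = to (ihψ j j≡) (h (from (ihφ j j≡) p))
          where j≡ : j ≡ num i
                j≡ = sym (succ-injective (succ-unique s))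
      truth {n} (∀′ φ) (suc i) (s≤s d) i≤N v e rep = evaluate i≤N 4 _ _ e ⇔∘ mk⇔ forth
        λ h → num i , succ-spec _ , λ x e′ ext → from (ih x e′ ext (num i) refl) (h x)
        where
        ih : ∀ x e′ → Extends e′ e (num n) x → ∀ j → j ≡ num i → Related₃ S j (code φ) e′ ⇔ Sat U φ (x ∷ v)
        ih x e′ ext _ refl = truth φ i d (<⇒≤ i≤N) (x ∷ v) e′ (represents-extend rep ext)
        forth : Branch 4 S (succ (num i)) (num n) (code φ) e → ∀ x → Sat U φ (x ∷ v)
        forth (j , s , h) x = to (ih x _ ext j (sym (succ-injective (succ-unique s)))) (h x _ ext)
          where ext : Extends (adjoin e ⟪ num n , x ⟫) e (num n) x
                ext = extends-adjoin e (num n) x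

  Describes : Class U → C → C → C → Set ℓ
  Describes S n d x = ∃[ u ] ∃[ r ] ∃[ c ] ∃[ e ] ∃[ e′ ]
    (IsOrderedPair U d u r × IsOrderedPair U r c e × Extends e′ e u x × Related₃ S n c e′)

  -- In a `Formula 2` the parameter has level 0 and the member variable level 1. So the assignment
  -- stores `z` under the name 0, and 1 is the name left open for the member.
  description : Class U → C
  description (ψ , z) = ⟪ num 1 , ⟪ code ψ , adjoin ∅ ⟪ num 0 , z ⟫ ⟫ ⟫

  opaque
    description-describes : ∀ {i S} (X : Class U) → depth (proj₁ X) ≤ i → Correct S (num i) →
                            ∀ x → Describes S (num i) (description X) x ⇔ _∈Class_ U x X
    description-describes {i} {S} (ψ , z) d correct x = mk⇔ forth back
      where
      e : C
      e = adjoin ∅ ⟪ num 0 , z ⟫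
      holds : ∀ e′ → Extends e′ e (num 1) x → Related₃ S (num i) (code ψ) e′ ⇔ Sat U ψ (x ∷ z ∷ [])
      holds e′ ext = truth correct ψ i d ≤-refl (x ∷ z ∷ []) e′
        (represents-extend (represents-extend represents-∅ (extends-adjoin ∅ (num 0) z)) ext)
      forth : Describes S (num i) (description (ψ , z)) x → Sat U ψ (x ∷ z ∷ [])
      forth (u , r , c , e₁ , e′ , o , o′ , ext , h) with ⟪⟫-injective (ordered-pair-unique o)
      ... | refl , refl with ⟪⟫-injective (ordered-pair-unique o′)
      ... | refl , refl = to (holds e′ ext) h
      back : Sat U ψ (x ∷ z ∷ []) → Describes S (num i) (description (ψ , z)) x
      back h = _ , _ , _ , _ , _ , ordered-pair _ _ , ordered-pair _ _ , ext , from (holds _ ext) h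
        where ext : Extends (adjoin e ⟪ num 1 , x ⟫) e (num 1) x
              ext = extends-adjoin e (num 1) x

  opaque
    describes-cong : ∀ {S S′ n} → Agree S S′ n → ∀ {d x} → Describes S n d x → Describes S′ n d x
    describes-cong agree (u , r , c , e , e′ , o , o′ , ext , h) = u , r , c , e , e′ , o , o′ , ext , to (agree _ _) h

-- The abstraction map when the urelements form a set

describedByF : ∀ {m n} → Fin m → Fin n → Fin n → Fm true m n
describedByF X n d = exᶜ (correctF 0F n ∧ all (0F ∊ᶜ suc X ⊂⊃ describesF 0F (suc n) (suc d) 0F))

describableF : ∀ {m n} → Fin m → Fin n → Fm true m n
describableF X n = ex (describedByF X (suc n) 0F)

minimalF : ∀ {m n} → Fin m → Fin n → Fin n → Fm true m n
minimalF X n d = describedByF X n d ∧ all (describedByF X (suc n) 0F ⊃ rankF (suc d) 0F)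

abstractF : ∀ {m n} → Fin m → Fin n → Fm true m n
abstractF X y = ex (ex (orderedPairF (suc (suc y)) 1F 0F ∧ naturalF 1F
  ∧ describableF X 1F ∧ all (0F ∊ 2F ⊃ not (describableF X 0F))
  ∧ setF 0F ∧ ex (0F ∊ 1F) ∧ all (0F ∊ 1F ⊂⊃ minimalF X 2F 0F)))

module Abstraction {ℓ} (em : ExcludedMiddle ℓ) (U : Structure ℓ) (Z : ZFUR U) (collection : Collection U)
                   (𝒜-set : UrelementsFormSet U) where
  open Recursion em U Z collection
  open Rank em U Z collection using (_≼_; scott)
  open Truth em U Z collection
  open ZFUR Z

  -- The quantifier over `S` is what makes the abstract second-order: no one formula defines the
  -- truth classes of all levels, but `Correct` recognizes each of them.
  DescribedBy : Class U → C → C → Set ℓ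
  DescribedBy X n d = ∃[ S ] (Correct S n × (∀ x → _∈Class_ U x X ⇔ Describes S n d x))

  opaque
    describedByF-spec : ∀ {m k} (X : Fin m) (n d : Fin k) {E e} →
                        ⟦ U ⟧ (describedByF X n d) E e ⇔ DescribedBy (lookup E X) (lookup e n) (lookup e d)
    describedByF-spec X n d {E} {e} = mk⇔
      (λ (S , h , k) → S , to (correctF-spec {true} 0F n {S ∷ E} {e}) h , k)
      (λ (S , h , k) → S , from (correctF-spec {true} 0F n {S ∷ E} {e}) h , k)

  Describable : Class U → C → Set ℓ
  Describable X n = ∃[ d ] DescribedBy X n d

  Minimal : Class U → C → C → Set ℓ
  Minimal X n d = DescribedBy X n d × (∀ d′ → DescribedBy X n d′ → d ≼ d′)

  opaque
    describableF-spec : ∀ {m k} (X : Fin m) (n : Fin k) {E e} →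
                        ⟦ U ⟧ (describableF X n) E e ⇔ Describable (lookup E X) (lookup e n)
    describableF-spec X n {E} {e} = mk⇔ (λ (d , h) → d , to (spec d) h) (λ (d , h) → d , from (spec d) h)
      where
      spec : ∀ d → ⟦ U ⟧ (describedByF X (suc n) 0F) E (d ∷ e) ⇔ DescribedBy (lookup E X) (lookup e n) d
      spec d = describedByF-spec X (suc n) 0F {E} {d ∷ e}

  opaque
    minimalF-spec : ∀ {m k} (X : Fin m) (n d : Fin k) {E e} →
                    ⟦ U ⟧ (minimalF X n d) E e ⇔ Minimal (lookup E X) (lookup e n) (lookup e d)
    minimalF-spec X n d {E} {e} = mk⇔
      (λ (h , min) → to (describedByF-spec X n d {E} {e}) h , λ d′ h′ → min d′ (from (spec d′) h′))
      (λ (h , min) → from (describedByF-spec X n d {E} {e}) h , λ d′ h′ → min d′ (to (spec d′) h′))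
      where
      spec : ∀ d′ → ⟦ U ⟧ (describedByF X (suc n) 0F) E (d′ ∷ e) ⇔ DescribedBy (lookup E X) (lookup e n) d′
      spec d′ = describedByF-spec X (suc n) 0F {E} {d′ ∷ e}

  IsAbstract : Class U → C → Set ℓ
  IsAbstract X y = ∃[ n ] ∃[ v ] (IsOrderedPair U y n v × Natural n
    × Describable X n × (∀ m → m ∈ n → ¬ Describable X m)
    × IsSet U v × (∃[ d ] d ∈ v) × (∀ d → (d ∈ v) ⇔ Minimal X n d))

  opaque
    abstractF-spec : ∀ {m k} (X : Fin m) (y : Fin k) {E e} →
                     ⟦ U ⟧ (abstractF X y) E e ⇔ IsAbstract (lookup E X) (lookup e y)
    abstractF-spec {m} {k} X y {E} {e} = mk⇔
      (λ (n , v , o , nat , h , least , set , inhabited , v-spec) →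
        n , v , o , nat , to (here n v) h , (λ m m∈ h → least m m∈ (from (below m n v) h)) , set , inhabited ,
        λ d → v-spec d ⇔∘ minimal d n v)
      (λ (n , v , o , nat , h , least , set , inhabited , v-spec) →
        n , v , o , nat , from (here n v) h , (λ m m∈ h → least m m∈ (to (below m n v) h)) , set , inhabited ,
        λ d → v-spec d ⇔∘ ⇔-sym (minimal d n v))
      where
      here : ∀ n v → ⟦ U ⟧ (describableF X 1F) E (v ∷ n ∷ e) ⇔ Describable (lookup E X) n
      here n v = describableF-spec X 1F {E} {v ∷ n ∷ e}
      below : ∀ i n v → ⟦ U ⟧ (describableF X 0F) E (i ∷ v ∷ n ∷ e) ⇔ Describable (lookup E X) i
      below i n v = describableF-spec X 0F {E} {i ∷ v ∷ n ∷ e}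
      minimal : ∀ d n v → ⟦ U ⟧ (minimalF X 2F 0F) E (d ∷ v ∷ n ∷ e) ⇔ Minimal (lookup E X) n d
      minimal d n v = minimalF-spec X 2F 0F {E} {d ∷ v ∷ n ∷ e}

  opaque
    abstractFormula : ∀ {m k} → Fin m → Fin k → Formula₂ m k
    abstractFormula X y = SecondOrder.formula (secondOrder (abstractF X y))
    abstractFormula-spec : ∀ {m k} (X : Fin m) (y : Fin k) {E e} →
                           Sat₂ U (abstractFormula X y) E e ⇔ IsAbstract (lookup E X) (lookup e y)
    abstractFormula-spec X y {E} {e} =
      SecondOrder.correct (secondOrder (abstractF X y)) E e ⇔∘ abstractF-spec X y {E} {e}

  SameMembers : Class U → Class U → Set ℓ
  SameMembers X Y = ∀ x → _∈Class_ U x X ⇔ _∈Class_ U x Y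

  opaque
    describedBy-cong : ∀ {X Y n d} → SameMembers X Y → DescribedBy X n d → DescribedBy Y n d
    describedBy-cong same (S , c , k) =
      S , c , λ x → ⇔-sym (same x) ⇔∘ k x

  opaque
    describedBy-extensional : ∀ {X Y n d} → Natural n → DescribedBy X n d → DescribedBy Y n d → SameMembers X Y
    describedBy-extensional {X} {Y} {n} {d} nat h h′ x with h | h′
    ... | S , c , k | S′ , c′ , k′ = k x ⇔∘ mk⇔ (describes-cong {S} {S′} (correct-unique nat c c′))
                                              (describes-cong {S′} {S} (correct-unique nat c′ c)) ⇔∘ ⇔-sym (k′ x)

  opaque
    isAbstract-cong : ∀ {X Y y} → SameMembers X Y → IsAbstract X y → IsAbstract Y y
    isAbstract-cong {X} {Y} same (n , v , o , nat , (d , h) , least , set , inhabited , v-spec) =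
      n , v , o , nat , (d , there h) , (λ m m∈ (d , h) → least m m∈ (d , back h)) , set , inhabited ,
      λ d → v-spec d ⇔∘ mk⇔ (λ (h , min) → there h , λ d′ h′ → min d′ (back h′))
                            (λ (h , min) → back h , λ d′ h′ → min d′ (there h′))
      where
      there : ∀ {n d} → DescribedBy X n d → DescribedBy Y n d
      there = describedBy-cong {X} {Y} same
      back : ∀ {n d} → DescribedBy Y n d → DescribedBy X n d
      back = describedBy-cong {Y} {X} λ x → ⇔-sym (same x)

  opaque
    isAbstract-unique : ∀ {X y y′} → IsAbstract X y → IsAbstract X y′ → y ≡ y′
    isAbstract-unique (n , v , o , nat , h , least , set , _ , v-spec) (n′ , v′ , o′ , nat′ , h′ , least′ , set′ , _ , v′-spec)
      with trichotomy n nat n′ nat′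
    ... | inj₁ n∈n′        = ⊥-elim (least′ n n∈n′ h)
    ... | inj₂ (inj₂ n′∈n) = ⊥-elim (least n′ n′∈n h′)
    ... | inj₂ (inj₁ refl) with extensionality v v′ set set′ (λ d → v-spec d ⇔∘ ⇔-sym (v′-spec d))
    ... | refl = trans (ordered-pair-unique o) (sym (ordered-pair-unique o′))

  opaque
    -- The level and the set `v` are recovered from the pair. As `v` is inhabited, some description
    -- in it belongs to both classes and determines their members.
    isAbstract-injective : ∀ {X Y y} → IsAbstract X y → IsAbstract Y y → SameMembers X Y
    isAbstract-injective {X} {Y} (n , v , o , nat , _ , _ , _ , (d , d∈) , v-spec) (n′ , v′ , o′ , _ , _ , _ , _ , _ , v′-spec)
      with ⟪⟫-injective (trans (sym (ordered-pair-unique o)) (ordered-pair-unique o′))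
    ... | refl , refl = describedBy-extensional {X} {Y} nat (proj₁ (to (v-spec d) d∈)) (proj₁ (to (v′-spec d) d∈))

  opaque
    described : ∀ X → DescribedBy X (num (depth (proj₁ X))) (description X)
    described X = (stage (suc i) , stage-correct i ,
      λ x → ⇔-sym (description-describes {i} {stage (suc i)} X ≤-refl (stage-correct i) x))
      where i : ℕ
            i = depth (proj₁ X)

  -- The least level is found among the standard numerals, where excluded middle gives the least number principle;
  -- the class of levels describing X need not be definable.
  opaque
    least-level : ∀ X → ∃[ i ] (Describable X (num i) × (∀ j → j < i → ¬ Describable X (num j)))
    least-level X with search (suc (depth (proj₁ X)))
      where
      Level : ℕ → Set ℓ
      Level i = Describable X (num i)
      search : ∀ k → (∃[ i ] (Level i × (∀ j → j < i → ¬ Level j))) ⊎ (∀ j → j < k → ¬ Level j)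
      search zero = inj₂ λ j ()
      search (suc k) with search k
      ... | inj₁ found = inj₁ found
      ... | inj₂ none with em {Level k}
      ... | yes h = inj₁ (k , h , none)
      ... | no ¬h = inj₂ λ j j<1+k → none′ (m≤n⇒m<n∨m≡n j<1+k)
        where
        none′ : ∀ {j} → suc j < suc k ⊎ suc j ≡ suc k → ¬ Level j
        none′ (inj₁ (s≤s j<k)) = none _ j<k
        none′ (inj₂ refl)      = ¬h
    ... | inj₁ found = found
    ... | inj₂ none  = ⊥-elim (none _ ≤-refl (_ , described X))

  opaque
    -- With a correct `S` held fixed, being a description becomes first-order, so the descriptions
    -- form a definable class to which `scott` applies.
    Descriptions : Class U → Class U → C → Class U
    Descriptions X S n = class₁ (all (0F ∊ᶜ 0F ⊂⊃ describesF 1F 2F 1F 0F)) (X ∷ S ∷ []) (n ∷ [])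
    descriptions-spec : ∀ X S n d → _∈Class_ U d (Descriptions X S n) ⇔ (∀ x → _∈Class_ U x X ⇔ Describes S n d x)
    descriptions-spec X S n d =
      class₁-spec (all (0F ∊ᶜ 0F ⊂⊃ describesF 1F 2F 1F 0F)) {X ∷ S ∷ []} {n ∷ []} {d}

  opaque
    descriptions⇔ : ∀ X S n d → Natural n → Correct S n → _∈Class_ U d (Descriptions X S n) ⇔ DescribedBy X n d
    descriptions⇔ X S n d nat correct = descriptions-spec X S n d ⇔∘ mk⇔ (λ k → S , correct , k)
      λ (S′ , correct′ , k) x → k x ⇔∘ mk⇔ (describes-cong {S′} {S} (correct-unique {S′} {S} nat correct′ correct))
                                         (describes-cong {S} {S′} (correct-unique {S} {S′} nat correct correct′))

  opaque
    abstract-exists : ∀ X → ∃[ y ] IsAbstract X y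
    abstract-exists X with least-level X
    ... | i , (d , described@(S , correct , _)) , least
      with scott 𝒜-set (Descriptions X S (num i)) (d , from (descriptions⇔ X S (num i) d (num-natural i) correct) described)
    ... | v , set , inhabited , v-spec =
      ⟪ num i , v ⟫ , num i , v , ordered-pair _ _ , num-natural i , (d , described) , smaller , set , inhabited ,
      λ e → v-spec e ⇔∘ mk⇔ (λ (e∈ , min) → to (iff e) e∈ , λ e′ h′ → min e′ (from (iff e′) h′))
                            (λ (h , min) → from (iff e) h , λ e′ e′∈ → min e′ (to (iff e′) e′∈))
      where
      iff : ∀ e → _∈Class_ U e (Descriptions X S (num i)) ⇔ DescribedBy X (num i) e
      iff e = descriptions⇔ X S (num i) e (num-natural i) correct
      smaller : ∀ m → m ∈ num i → ¬ Describable X m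
      -- Members of a numeral are numerals, so leastness among the external numbers yields leastness
      -- inside `U`.
      smaller m m∈ with num-∈⁻ i m∈
      ... | j , j<i , refl = least j j<i

  opaque
    abstraction : ∃[ ϵ ] (Definable U ϵ × BasicLawV U ϵ)
    abstraction = ϵ ,
      (abstractFormula 0F 0F , λ X y → abstractFormula-spec 0F 0F {X ∷ []} {y ∷ []} ⇔∘
        mk⇔ (isAbstract-unique {X} (ϵ-abstract X)) λ e → subst (IsAbstract X) e (ϵ-abstract X)) ,
      λ X Y → mk⇔
        (λ e → isAbstract-injective {X} {Y} (subst (IsAbstract X) e (ϵ-abstract X)) (ϵ-abstract Y))
        λ same → isAbstract-unique {Y} (isAbstract-cong {X} {Y} same (ϵ-abstract X)) (ϵ-abstract Y)
      where
      ϵ : Class U → C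
      ϵ X = proj₁ (abstract-exists X)
      ϵ-abstract : ∀ X → IsAbstract X (ϵ X)
      ϵ-abstract X = proj₂ (abstract-exists X)

-- Assembly of the three-way equivalence

definable⇒parametricallyDefinable :
  ∀ {ℓ} (U : Structure ℓ) → Class U → ∀ {ϵ} → Definable U ϵ → ParametricallyDefinable U ϵ
definable⇒parametricallyDefinable U P (φ , correct) = renᶜ (λ { 0F → 0F }) φ , P ,
  λ X y → Semantics.sat-renᶜ U φ (λ { 0F → refl }) ⇔∘ correct X y

theorem3 : ∀ {ℓ} → ExcludedMiddle ℓ →
    (U : Structure ℓ) → ZFUR U → Collection U → ACω U →
    (UrelementsFormSet U ⇔ (∃[ ε ] (Definable U ε × BasicLawV U ε)))
    × ((∃[ ε ] (Definable U ε × BasicLawV U ε)) ⇔ (∃[ ε ] (ParametricallyDefinable U ε × BasicLawV U ε)))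
theorem3 em U Z collection acω =
  mk⇔ set⇒definable (parametric⇒set ∘ parametric) , mk⇔ parametric (set⇒definable ∘ parametric⇒set)
  where
  set⇒definable : UrelementsFormSet U → ∃[ ϵ ] (Definable U ϵ × BasicLawV U ϵ)
  set⇒definable = Abstraction.abstraction em U Z collection
  parametric : ∃[ ϵ ] (Definable U ϵ × BasicLawV U ϵ) → ∃[ ϵ ] (ParametricallyDefinable U ϵ × BasicLawV U ϵ)
  parametric (ϵ , definable , law) =
    ϵ , definable⇒parametricallyDefinable U (⊥′ , SetTheory.∅ em U Z) definable , law
  parametric⇒set : ∃[ ϵ ] (ParametricallyDefinable U ϵ × BasicLawV U ϵ) → UrelementsFormSet U
  parametric⇒set (ϵ , definable , law) = SetTheory.byContradiction em U Z λ proper →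
    ProperClass.no-abstraction em U Z collection acω proper ϵ definable law
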